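{- Let $G$ be a finitely generated group. If $G$ contains an element of order at least $(5\operatorname{rank}(G))^{12}$ (infinite order being allowed), then $G$ has a locally finite directed Cayley graph whose only automorphisms are the left-multiplications by elements of $G$. If moreover $G$ is not a generalized dihedral group, then this digraph can be chosen without bigons.
   Context: A digraph is a pair $(V,E)$ with $E\subset V\times V$ disjoint from the diagonal; an automorphism is a permutation $\varphi$ of $V$ with $(x,y)\in E$ iff $(\varphi(x),\varphi(y))\in E$. A bigon is an arc $(x,y)$ such that $(y,x)$ is also an arc. For a generating set $S$ of $G$ with $1_G\notin S$, the directed Cayley graph of $(G,S)$ has vertex set $G$ and arc set $\{(g,gs)\mid g\in G,s\in S\}$; it is locally finite iff $S$ is finite. $\operatorname{rank}(G)$ is the smallest cardinality of a generating set of $G$. A generalized dihedral group is a semidirect product $A\rtimes \mathbf{Z}/2\mathbf{Z}$ with $A$ abelian and $\mathbf{Z}/2\mathbf{Z}$ acting on $A$ by inversion. -}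

module Defs where

open import Algebra.Bundles using (Group; AbelianGroup)
open import Algebra.Definitions.RawMonoid using () renaming (_×_ to _times_)
open import Algebra.Morphism.Structures using (module GroupMorphisms)
import Algebra.Properties.AbelianGroup as AbelianGroupProperties
import Algebra.Properties.Group as GroupProperties
open import Axiom.ExcludedMiddle using (ExcludedMiddle)
open import Data.Fin.Base using (Fin)
open import Data.Nat.Base using (ℕ; _≤_; _<_)
open import Data.Nat.Induction using (<-wellFounded)
import Data.Nat.Properties as ℕ
open import Data.Parity.Base using (Parity; 0ℙ; 1ℙ; _+_)
import Data.Parity.Properties as ℙ
open import Data.Product.Base using (Σ; ∃; _×_; _,_; proj₁; proj₂)
open import Data.Product.Relation.Binary.Pointwise.NonDependent using (×-setoid)
open import Data.Sum.Base using (_⊎_)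
open import Function.Bundles using (Inverse; _⇔_)
open import Induction.WellFounded using (Acc; acc)
open import Level using (Level; _⊔_; suc)
open import Relation.Binary.Bundles using (Setoid)
open import Relation.Binary.Core using (Rel)
open import Relation.Binary.Definitions using (Irreflexive; _Respects_; _Respects₂_)
import Relation.Binary.Construct.On as On
open import Relation.Binary.PropositionalEquality as ≡ using (_≡_)
open import Relation.Nullary.Decidable.Core using (yes; no)
open import Relation.Nullary.Negation.Core using (¬_)
open import Relation.Unary using (Pred; _∈_; _∉_)

private
  variable
    a c ℓ p : Level

------------------------------------------------------------------------
-- Cardinality of subsets of a setoid

subsetoid : (A : Setoid a ℓ) → Pred (Setoid.Carrier A) p → Setoid (a ⊔ p) ℓ
subsetoid A P = On.setoid {B = ∃ P} A proj₁

HasCardinality : (A : Setoid a ℓ) → Pred (Setoid.Carrier A) p → ℕ → Set (a ⊔ ℓ ⊔ p)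
HasCardinality A P n = Inverse (≡.setoid (Fin n)) (subsetoid A P)

Finite : (A : Setoid a ℓ) → Pred (Setoid.Carrier A) p → Set (a ⊔ ℓ ⊔ p)
Finite A P = ∃ λ n → HasCardinality A P n

------------------------------------------------------------------------
-- Digraphs

record Digraph (v ℓ e : Level) : Set (suc (v ⊔ ℓ ⊔ e)) where
  field
    vertices : Setoid v ℓ

  open Setoid vertices public using (_≈_) renaming (Carrier to Vertex)

  field
    Arc         : Rel Vertex e
    Arc-resp-≈  : Arc Respects₂ _≈_
    irreflexive : Irreflexive _≈_ Arc

module _ {v ℓ e : Level} (Γ : Digraph v ℓ e) where
  open Digraph Γ

  IsAutomorphism : Inverse vertices vertices → Set (v ⊔ e)
  IsAutomorphism φ = ∀ x y → Arc x y ⇔ Arc (Inverse.to φ x) (Inverse.to φ y)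

  LocallyFinite : Set (v ⊔ ℓ ⊔ e)
  LocallyFinite = ∀ x → Finite vertices (λ y → Arc x y) × Finite vertices (λ y → Arc y x)

  IsBigon : Vertex → Vertex → Set e
  IsBigon x y = Arc x y × Arc y x

  WithoutBigons : Set (v ⊔ e)
  WithoutBigons = ∀ x y → ¬ IsBigon x y

------------------------------------------------------------------------
-- Generating sets, rank, order of elements, Cayley digraphs

module _ (G : Group c ℓ) where
  open Group G hiding (_//_; _\\_)

  data Generated (S : Pred Carrier p) : Pred Carrier (c ⊔ ℓ ⊔ p) where
    gen    : ∀ {x} → x ∈ S → x ∈ Generated S
    unit   : ε ∈ Generated S
    mul    : ∀ {x y} → x ∈ Generated S → y ∈ Generated S → x ∙ y ∈ Generated S
    inv    : ∀ {x} → x ∈ Generated S → x ⁻¹ ∈ Generated S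
    resp-≈ : ∀ {x y} → x ≈ y → x ∈ Generated S → y ∈ Generated S

  -- The level c ⊔ ℓ is that of membership in a list of elements, so that every
  -- finite subset of G is available.
  record GeneratingSet : Set (suc (c ⊔ ℓ)) where
    field
      Member    : Pred Carrier (c ⊔ ℓ)
      respects  : Member Respects _≈_
      generates : ∀ x → x ∈ Generated Member

  open GeneratingSet

  FinitelyGenerated : Set (suc (c ⊔ ℓ))
  FinitelyGenerated = Σ GeneratingSet λ S → Finite setoid (Member S)

  -- For finitely generated groups only: r is the rank as a natural number.
  IsRank : ℕ → Set (suc (c ⊔ ℓ))
  IsRank r = (Σ GeneratingSet λ S → HasCardinality setoid (Member S) r)
           × (∀ (S : GeneratingSet) n → HasCardinality setoid (Member S) n → r ≤ n)

  rank-unique : ∀ {r s} → IsRank r → IsRank s → r ≡ s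
  rank-unique ((S , ∣S∣≡r) , r-min) ((T , ∣T∣≡s) , s-min) =
    ℕ.≤-antisym (r-min T _ ∣T∣≡s) (s-min S _ ∣S∣≡r)

  rank-exists : (∀ {a} → ExcludedMiddle a) → FinitelyGenerated → ∃ λ r → IsRank r
  rank-exists em (S , n , ∣S∣≡n) = least n (<-wellFounded n) (S , ∣S∣≡n)
    where
    HasSize : ℕ → Set (suc (c ⊔ ℓ))
    HasSize m = Σ GeneratingSet λ T → HasCardinality setoid (Member T) m

    least : ∀ m → Acc _<_ m → HasSize m → ∃ λ r → IsRank r
    least m (acc rec) h with em {P = ∃ λ k → k < m × HasSize k}
    ... | yes (k , k<m , h′) = least k (rec k<m) h′
    ... | no ∄smaller = m , h , λ T k ∣T∣≡k →
      ℕ.≮⇒≥ λ k<m → ∄smaller (k , k<m , T , ∣T∣≡k)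

  pow : Carrier → ℕ → Carrier
  pow x n = _times_ rawMonoid n x

  HasOrder : Carrier → ℕ → Set ℓ
  HasOrder x n = 0 < n × pow x n ≈ ε × (∀ m → 0 < m → pow x m ≈ ε → n ≤ m)

  HasInfiniteOrder : Carrier → Set ℓ
  HasInfiniteOrder x = ∀ m → 0 < m → ¬ (pow x m ≈ ε)

  OrderAtLeast : ℕ → Carrier → Set ℓ
  OrderAtLeast N x = HasInfiniteOrder x ⊎ (∃ λ n → HasOrder x n × N ≤ n)

  cayleyDigraph : (S : GeneratingSet) → ε ∉ Member S → Digraph c ℓ (c ⊔ ℓ)
  cayleyDigraph S ε∉S = record
    { vertices    = setoid
    ; Arc         = λ g h → ∃ λ s → s ∈ Member S × h ≈ g ∙ s
    ; Arc-resp-≈  =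
        (λ h≈h′ (s , s∈S , h≈gs) → s , s∈S , trans (sym h≈h′) h≈gs) ,
        (λ g≈g′ (s , s∈S , h≈gs) → s , s∈S , trans h≈gs (∙-congʳ g≈g′))
    ; irreflexive = λ {g} g≈h (s , s∈S , h≈gs) →
        let ε≈s = GroupProperties.∙-cancelˡ G g ε s
                    (trans (identityʳ g) (trans g≈h h≈gs))
        in ε∉S (respects S (sym ε≈s) s∈S)
    }

  IsLeftMultiplication : Inverse setoid setoid → Set (c ⊔ ℓ)
  IsLeftMultiplication φ = ∃ λ g → ∀ x → Inverse.to φ x ≈ g ∙ x

  AutomorphismsAreLeftMultiplications : (S : GeneratingSet) → ε ∉ Member S → Set (c ⊔ ℓ)
  AutomorphismsAreLeftMultiplications S ε∉S =
    ∀ φ → IsAutomorphism (cayleyDigraph S ε∉S) φ ⇔ IsLeftMultiplication φ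

------------------------------------------------------------------------
-- Generalized dihedral groups

module _ (A : AbelianGroup a ℓ) where
  open AbelianGroup A
  open AbelianGroupProperties A using (⁻¹-∙-comm)
  open GroupProperties group using (⁻¹-involutive; ε⁻¹≈ε)

  infixr 8 _▷_

  _▷_ : Parity → Carrier → Carrier
  0ℙ ▷ x = x
  1ℙ ▷ x = x ⁻¹

  private
    ▷-cong : ∀ s {x y} → x ≈ y → s ▷ x ≈ s ▷ y
    ▷-cong 0ℙ x≈y = x≈y
    ▷-cong 1ℙ x≈y = ⁻¹-cong x≈y

    ▷-homo-∙ : ∀ s x y → s ▷ (x ∙ y) ≈ s ▷ x ∙ s ▷ y
    ▷-homo-∙ 0ℙ x y = refl
    ▷-homo-∙ 1ℙ x y = sym (⁻¹-∙-comm x y)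

    ▷-homo-ε : ∀ s → s ▷ ε ≈ ε
    ▷-homo-ε 0ℙ = refl
    ▷-homo-ε 1ℙ = ε⁻¹≈ε

    ▷-action : ∀ s t x → (s + t) ▷ x ≈ s ▷ t ▷ x
    ▷-action 0ℙ t  x = refl
    ▷-action 1ℙ 0ℙ x = refl
    ▷-action 1ℙ 1ℙ x = sym (⁻¹-involutive x)

    ▷-self-inverse : ∀ s x → s ▷ s ▷ x ≈ x
    ▷-self-inverse 0ℙ x = refl
    ▷-self-inverse 1ℙ x = ⁻¹-involutive x

  -- The semidirect product A ⋊ Z/2Z, with Z/2Z the additive group of parities
  -- acting on A by inversion.
  generalizedDihedral : Group a ℓ
  generalizedDihedral = record
    { Carrier = Carrier × Parity
    ; _≈_     = Setoid._≈_ S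
    ; _∙_     = λ (x , s) (y , t) → x ∙ s ▷ y , s + t
    ; ε       = ε , 0ℙ
    ; _⁻¹     = λ (x , s) → s ▷ (x ⁻¹) , s
    ; isGroup = record
      { isMonoid = record
        { isSemigroup = record
          { isMagma = record
            { isEquivalence = Setoid.isEquivalence S
            ; ∙-cong = λ { {_ , s} (x≈x′ , ≡.refl) (y≈y′ , ≡.refl) →
                ∙-cong x≈x′ (▷-cong s y≈y′) , ≡.refl }
            }
          ; assoc = λ (x , s) (y , t) (z , u) →
              trans (∙-congˡ (▷-action s t z))
                (trans (assoc x (s ▷ y) (s ▷ t ▷ z))
                  (∙-congˡ (sym (▷-homo-∙ s y (t ▷ z))))) ,
              ℙ.+-assoc s t u
          }
        ; identity =
            (λ (x , s) → identityˡ x , ≡.refl) ,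
            (λ (x , s) → trans (∙-congˡ (▷-homo-ε s)) (identityʳ x) , ℙ.+-identityʳ s)
        }
      ; inverse =
          (λ (x , s) →
            trans (sym (▷-homo-∙ s (x ⁻¹) x))
              (trans (▷-cong s (inverseˡ x)) (▷-homo-ε s)) ,
            ℙ.p+p≡0ℙ s) ,
          (λ (x , s) →
            trans (∙-congˡ (▷-self-inverse s (x ⁻¹))) (inverseʳ x) ,
            ℙ.p+p≡0ℙ s)
      ; ⁻¹-cong = λ { {_ , s} (x≈x′ , ≡.refl) → ▷-cong s (⁻¹-cong x≈x′) , ≡.refl }
      }
    }
    where
    S : Setoid a ℓ
    S = ×-setoid setoid (≡.setoid Parity)

IsGeneralizedDihedral : Group c ℓ → Set (suc (c ⊔ ℓ))
IsGeneralizedDihedral {c = c} {ℓ = ℓ} G =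
  Σ (AbelianGroup c ℓ) λ A →
    let D = generalizedDihedral A in
    ∃ λ f → GroupMorphisms.IsGroupIsomorphism (Group.rawGroup D) (Group.rawGroup G) f

{-# OPTIONS --safe #-}
module Submission where

open import Defs
open import Algebra.Bundles using (Group; AbelianGroup)
import Algebra.Properties.Group as GroupProperties
import Algebra.Properties.Monoid.Mult as Mult
open import Axiom.ExcludedMiddle using (ExcludedMiddle)
open import Data.Fin.Base as Fin using (Fin; toℕ)
import Data.Fin.Properties as Fin
open import Data.List.Base using (List; []; _∷_; _++_; length; lookup; map; applyUpTo; deduplicate; tabulate)
open import Data.List.Membership.Propositional using () renaming (_∈_ to _∈ₚ_)
import Data.List.Membership.Propositional.Properties as Propositionalₚ
import Data.List.Membership.Setoid as Membership
import Data.List.Membership.Setoid.Properties as Membershipₚ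
import Data.List.Properties as List
open import Data.List.Relation.Unary.All as All using (All; []; _∷_)
open import Data.List.Relation.Unary.AllPairs using ([]; _∷_)
open import Data.List.Relation.Unary.Any using (here; there; index)
open import Data.List.Relation.Unary.Any.Properties using (lookup-index)
open import Data.List.Relation.Unary.Unique.DecSetoid.Properties using (deduplicate-!)
open import Data.List.Relation.Unary.Unique.Setoid using (Unique)
open import Data.Nat.Base as ℕ using (ℕ; zero; suc; _*_; _^_; _<_; _≤_; z≤n; s≤s; ⌊_/2⌋)
import Data.Nat.Properties as ℕ
open import Data.Nat.Solver using (module +-*-Solver)
open import Data.Parity.Base using (0ℙ; 1ℙ)
open import Data.Product.Base using (Σ; ∃; ∃₂; _×_; _,_; proj₁; proj₂)
open import Data.Sum.Base as Sum using (_⊎_; inj₁; inj₂)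
open import Data.Unit.Base using (⊤; tt)
open import Function.Base using (_∘_)
open import Function.Bundles using (Inverse; Equivalence; _⇔_; mk⇔)
open import Level using (Level)
open import Relation.Binary.Bundles using (Setoid; DecSetoid)
open import Relation.Binary.Definitions using (tri<; tri≈; tri>)
open import Relation.Binary.PropositionalEquality as ≡ using (_≡_)
import Relation.Binary.Reasoning.Setoid as SetoidReasoning
open import Relation.Nullary.Decidable using (True; toWitness; fromWitness)
open import Relation.Nullary.Decidable.Core using (Dec; yes; no)
open import Relation.Nullary.Negation.Core using (¬_; contradiction)
open import Relation.Unary using (Pred; _∉_)

-- Let x have large order and let s₁ , … , s_k be representatives of distinct left cosets of
-- ⟨ x ⟩, other than ⟨ x ⟩ itself, which generate G together with x. Take as generators the powers
-- x , … , x^M and the pairs s_i , s_i x^(d_i) with distinct small distances d_i. When M is large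
-- compared with k, an arc coloured by x lies in more transitive triangles than any arc not
-- coloured by a power of x, so an automorphism φ maps x-arcs to arcs coloured by powers of x. The
-- path g , g x , … , g x^M, closed by an arc from its first to its last vertex, then forces φ to
-- preserve the colour x. Finally φ maps the pair g s_i , g s_i x^(d_i) to a pair of the same
-- distance, so it preserves the colours s_i as well.
--
-- Each s_i may be moved inside s_i ⟨ x ⟩, and this freedom lets one avoid bigons greedily, unless
-- all of s_i ⟨ x ⟩ consists of involutions, which means that s_i is an involution inverting x.
-- Such generators can be traded for others except when G is generalized dihedral.

-- Lists in a setoid: pigeonhole and finite subsets.

module _ {a ℓ} (A : Setoid a ℓ) where
  open Setoid A
  open Membership A using (_∈_) renaming (_∉_ to _∉ˡ_)

  lookup-injective : ∀ {xs} → Unique A xs → ∀ i j → lookup xs i ≈ lookup xs j → i ≡ j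
  lookup-injective (_ ∷ _) Fin.zero Fin.zero _ = ≡.refl
  lookup-injective (x≉ ∷ _) Fin.zero (Fin.suc j) eq =
    contradiction eq (All.lookup x≉ (Propositionalₚ.∈-lookup j))
  lookup-injective (x≉ ∷ _) (Fin.suc i) Fin.zero eq =
    contradiction (sym eq) (All.lookup x≉ (Propositionalₚ.∈-lookup i))
  lookup-injective (_ ∷ xs!) (Fin.suc i) (Fin.suc j) eq = ≡.cong Fin.suc (lookup-injective xs! i j eq)

  pigeonhole-∈ : ∀ {xs n} → length xs < n → (f : Fin n → Carrier) → (∀ i → f i ∈ xs) →
                 ∃₂ λ i j → i Fin.< j × f i ≈ f j
  pigeonhole-∈ {xs} xs<n f f∈xs with Fin.pigeonhole xs<n (λ i → index (f∈xs i))
  ... | i , j , i<j , eq = i , j , i<j ,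
    trans (lookup-index (f∈xs i)) (trans (reflexive (≡.cong (lookup xs) eq)) (sym (lookup-index (f∈xs j))))

  module _ (em : ∀ {a} → ExcludedMiddle a) where

    -- If all n values lay in `xs`, two of them would share a position in this shorter list.
    escape : ∀ xs {n} → length xs < n → (f : ℕ → Carrier) →
             (∀ {i j} → i < n → j < n → f i ≈ f j → i ≡ j) →
             ∃ λ i → i < n × f i ∉ˡ xs
    escape xs {n} xs<n f f-inj with em {P = ∃ λ i → i < n × f i ∉ˡ xs}
    ... | yes found = found
    ... | no  none with pigeonhole-∈ xs<n (f ∘ toℕ) inside
      where
      inside : ∀ i → f (toℕ {n} i) ∈ xs
      inside i with em {P = f (toℕ i) ∈ xs}
      ... | yes p = p
      ... | no ¬p = contradiction (toℕ i , Fin.toℕ<n i , ¬p) none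
    ...   | i , j , i<j , eq =
      contradiction (f-inj (Fin.toℕ<n i) (Fin.toℕ<n j) eq) (ℕ.<⇒≢ i<j)

    -- Excluded middle decides equality, so repetitions can be removed; the positions in the
    -- remaining list then enumerate the subset bijectively.
    list⇒Finite : ∀ {p} {P : Pred Carrier p} xs → (∀ {y} → P y ⇔ y ∈ xs) → Finite A P
    list⇒Finite {P = P} xs P⇔xs = length ys , record
      { to        = λ i → lookup ys i , Equivalence.from P⇔xs
          (Membershipₚ.∈-deduplicate⁻ A _≟_ xs (Membershipₚ.∈-lookup A ys i))
      ; from      = λ (_ , Py) → index (Py⇒∈ Py)
      ; to-cong   = λ { ≡.refl → refl }
      ; from-cong = λ {(_ , Py)} {(_ , Pz)} y≈z → lookup-injective ys! _ _
          (trans (sym (lookup-index (Py⇒∈ Py))) (trans y≈z (lookup-index (Py⇒∈ Pz))))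
      ; inverse   =
          (λ { {_ , Py} ≡.refl → sym (lookup-index (Py⇒∈ Py)) }) ,
          (λ {i} {(_ , Py)} y≈ → lookup-injective ys! _ _
            (trans (sym (lookup-index (Py⇒∈ Py))) y≈))
      }
      where
      _≟_ : ∀ x y → _
      _≟_ x y = em {P = x ≈ y}
      D : DecSetoid a ℓ
      D = record { isDecEquivalence = record { isEquivalence = isEquivalence ; _≟_ = _≟_ } }
      ys : List Carrier
      ys = deduplicate _≟_ xs
      ys! : Unique A ys
      ys! = deduplicate-! D xs
      Py⇒∈ : ∀ {y} → P y → y ∈ ys
      Py⇒∈ Py = Membershipₚ.∈-deduplicate⁺ A _≟_ (λ x≈y z≈x → trans z≈x (sym x≈y)) (Equivalence.to P⇔xs Py)

-- Numerical bounds.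

-- R pairs (s , d) give 2R elements outside ⟨ x ⟩, hence at most 4R common out-neighbours
-- for an arc not coloured by a power of x, whereas x , … , x^M give M - 1 to an arc coloured by x.
pathLength : ℕ → ℕ
pathLength R = suc (suc ((R ℕ.+ R) ℕ.+ (R ℕ.+ R)))

-- D bounds the distances obtained from n greedy steps. Comparing pairs adds two exponents below D,
-- and their sum has to stay in the range where powers of x are distinct.
distance-bound : ∀ {n R} → n ≤ R → let D = suc (n * ((R ℕ.+ R) ℕ.+ (R ℕ.+ R))) in
                 D ℕ.+ D ≤ pathLength R * pathLength R
distance-bound {n} {R} n≤R = begin
  suc (n * K) ℕ.+ suc (n * K) ≡⟨ ≡.cong suc (ℕ.+-suc (n * K) (n * K)) ⟩
  2 ℕ.+ (n * K ℕ.+ n * K)     ≤⟨ ℕ.+-monoʳ-≤ 2 (ℕ.+-mono-≤ nK≤RK nK≤RK) ⟩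
  2 ℕ.+ (R * K ℕ.+ R * K)     ≡⟨ ≡.cong (2 ℕ.+_) (ℕ.*-distribʳ-+ K R R) ⟨
  2 ℕ.+ (R ℕ.+ R) * K         ≤⟨ ℕ.+-mono-≤ (ℕ.m≤m+n 2 K) (ℕ.*-mono-≤ (ℕ.m≤m+n (R ℕ.+ R) (R ℕ.+ R)) (ℕ.m≤n+m K 2)) ⟩
  M ℕ.+ K * M                 ≤⟨ ℕ.+-monoʳ-≤ M (ℕ.m≤n+m (K * M) M) ⟩
  M * M                       ∎
  where
  open ℕ.≤-Reasoning
  K M : ℕ
  K = (R ℕ.+ R) ℕ.+ (R ℕ.+ R)
  M = pathLength R
  nK≤RK : n * K ≤ R * K
  nK≤RK = ℕ.*-monoˡ-≤ K n≤R

-- With n = 5 (r + 1), the path length 10 + 4r is at most 2n, and 4n² + 1 ≤ 5n² ≤ n³ because n ≥ 5.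
order-bound : ∀ r → suc (pathLength (2 ℕ.+ r) * pathLength (2 ℕ.+ r)) ≤ (5 * suc r) ^ 12
order-bound r = ℕ.≤-trans (s≤s (ℕ.*-mono-≤ p≤2n p≤2n)) (ℕ.≤-trans 4n²<n³ (ℕ.^-monoʳ-≤ n (ℕ.m≤m+n 3 9)))
  where
  open +-*-Solver
  n : ℕ
  n = 5 * suc r

  p≤2n : pathLength (2 ℕ.+ r) ≤ n ℕ.+ n
  p≤2n = ≡.subst (pathLength (2 ℕ.+ r) ≤_)
    (solve 1 (λ r → con 2 :+ (((con 2 :+ r) :+ (con 2 :+ r)) :+ ((con 2 :+ r) :+ (con 2 :+ r))) :+ con 6 :* r
                 := con 5 :* (con 1 :+ r) :+ con 5 :* (con 1 :+ r)) ≡.refl r)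
    (ℕ.m≤m+n _ (6 * r))

  4n²<n³ : suc ((n ℕ.+ n) * (n ℕ.+ n)) ≤ n ^ 3
  4n²<n³ = begin
    suc ((n ℕ.+ n) * (n ℕ.+ n))    ≤⟨ ℕ.+-monoˡ-≤ _ (ℕ.*-mono-≤ {1} {n} {1} {n} (s≤s z≤n) (s≤s z≤n)) ⟩
    n * n ℕ.+ (n ℕ.+ n) * (n ℕ.+ n) ≡⟨ solve 1 (λ n → n :* n :+ (n :+ n) :* (n :+ n) := con 5 :* (n :* n)) ≡.refl n ⟩
    5 * (n * n)                    ≤⟨ ℕ.*-monoˡ-≤ (n * n) (ℕ.m≤m*n 5 (suc r)) ⟩
    n * (n * n)                    ≡⟨ ≡.cong (λ k → n * (n * k)) (ℕ.*-identityʳ n) ⟨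
    n ^ 3                          ∎
    where open ℕ.≤-Reasoning

-- Generated subgroups and maps commuting with right multiplications.

module GroupLemmas {c ℓ : Level} (G : Group c ℓ) where
  open Group G hiding (_//_; _\\_)
  open GroupProperties G renaming (\\-leftDividesʳ to cancel-⁻¹ˡ; \\-leftDividesˡ to cancelˡ-⁻¹)
  open Membership setoid using (_∈_) public
  open SetoidReasoning setoid

  span : List Carrier → Pred Carrier _
  span xs = Generated G (_∈ xs)

  module _ {p q} {S : Pred Carrier p} {T : Pred Carrier q} where

    generated-⊆ : (∀ {x} → S x → Generated G T x) → ∀ {x} → Generated G S x → Generated G T x
    generated-⊆ f (gen x∈S)      = f x∈S
    generated-⊆ f unit           = unit
    generated-⊆ f (mul u v)      = mul (generated-⊆ f u) (generated-⊆ f v)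
    generated-⊆ f (inv u)        = inv (generated-⊆ f u)
    generated-⊆ f (resp-≈ x≈y u) = resp-≈ x≈y (generated-⊆ f u)

  inverse-comm : ∀ {u v} → u ∙ v ≈ ε → v ∙ u ≈ ε
  inverse-comm {u} {v} uv≈ε = trans (∙-congʳ (inverseʳ-unique u v uv≈ε)) (inverseˡ u)

  -- Conjugation by s inverts u, because s and s u equal their own inverses.
  involutions⇒inversion : ∀ {s u} → s ∙ s ≈ ε → (s ∙ u) ∙ (s ∙ u) ≈ ε → s ∙ u ≈ u ⁻¹ ∙ s
  involutions⇒inversion {s} {u} s²≈ε su²≈ε = begin
    s ∙ u       ≈⟨ inverseˡ-unique (s ∙ u) (s ∙ u) su²≈ε ⟩
    (s ∙ u) ⁻¹  ≈⟨ ⁻¹-anti-homo-∙ s u ⟩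
    u ⁻¹ ∙ s ⁻¹ ≈⟨ ∙-congˡ (inverseˡ-unique s s s²≈ε) ⟨
    u ⁻¹ ∙ s    ∎

  module _ {p} {S : Pred Carrier p} where

    cancelʳ-∈ : ∀ {u v} → Generated G S v → Generated G S (u ∙ v) → Generated G S u
    cancelʳ-∈ {u} {v} v∈ uv∈ = resp-≈ (//-rightDividesʳ v u) (mul uv∈ (inv v∈))

    cancelˡ-∈ : ∀ {u v} → Generated G S u → Generated G S (u ∙ v) → Generated G S v
    cancelˡ-∈ {u} {v} u∈ uv∈ = resp-≈ (cancel-⁻¹ˡ u v) (mul (inv u∈) uv∈)

  -- The right multiplications that φ commutes with form a group. For a generating set and g = ε
  -- this gives φ u = φ ε u, so φ is a left multiplication.
  commutes-on-generated :
    ∀ {p} {S : Pred Carrier p} {φ : Carrier → Carrier} → (∀ {u v} → u ≈ v → φ u ≈ φ v) →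
    (∀ {s} → S s → ∀ g → φ (g ∙ s) ≈ φ g ∙ s) →
    ∀ {s} → Generated G S s → ∀ g → φ (g ∙ s) ≈ φ g ∙ s
  commutes-on-generated φ-cong φ-S (gen s∈S) g = φ-S s∈S g
  commutes-on-generated {φ = φ} φ-cong φ-S unit g = trans (φ-cong (identityʳ g)) (sym (identityʳ (φ g)))
  commutes-on-generated {φ = φ} φ-cong φ-S (mul {s} {t} s∈ t∈) g = begin
    φ (g ∙ (s ∙ t)) ≈⟨ φ-cong (assoc g s t) ⟨
    φ ((g ∙ s) ∙ t) ≈⟨ commutes-on-generated φ-cong φ-S t∈ (g ∙ s) ⟩
    φ (g ∙ s) ∙ t   ≈⟨ ∙-congʳ (commutes-on-generated φ-cong φ-S s∈ g) ⟩
    (φ g ∙ s) ∙ t   ≈⟨ assoc (φ g) s t ⟩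
    φ g ∙ (s ∙ t)   ∎
  commutes-on-generated {φ = φ} φ-cong φ-S (inv {s} s∈) g = begin
    φ (g ∙ s ⁻¹)               ≈⟨ //-rightDividesʳ s _ ⟨
    (φ (g ∙ s ⁻¹) ∙ s) ∙ s ⁻¹  ≈⟨ ∙-congʳ (commutes-on-generated φ-cong φ-S s∈ (g ∙ s ⁻¹)) ⟨
    φ ((g ∙ s ⁻¹) ∙ s) ∙ s ⁻¹  ≈⟨ ∙-congʳ (φ-cong (//-rightDividesˡ s g)) ⟩
    φ g ∙ s ⁻¹                 ∎
  commutes-on-generated φ-cong φ-S (resp-≈ s≈t s∈) g =
    trans (φ-cong (∙-congˡ (sym s≈t))) (trans (commutes-on-generated φ-cong φ-S s∈ g) (∙-congˡ s≈t))

  -- Powers of x, left cosets of ⟨ x ⟩ and the shape of the generating set.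

  module Powers (x : Carrier) where
    x^_ : ℕ → Carrier
    x^ n = pow G x n

    infix 9 x^_

    x^-homo : ∀ m n → x^ (m ℕ.+ n) ≈ x^ m ∙ x^ n
    x^-homo = Mult.×-homo-+ monoid x

    ⟨x⟩ : Pred Carrier _
    ⟨x⟩ = span (x ∷ [])

    x^∈⟨x⟩ : ∀ n → ⟨x⟩ (x^ n)
    x^∈⟨x⟩ zero    = unit
    x^∈⟨x⟩ (suc n) = mul (gen (here refl)) (x^∈⟨x⟩ n)

    infix 4 _~_
    -- Equality of the left cosets u ⟨ x ⟩ and v ⟨ x ⟩.
    _~_ : Carrier → Carrier → Set _
    u ~ v = ⟨x⟩ (u ⁻¹ ∙ v)

    ~-reflexive : ∀ {u v} → u ≈ v → u ~ v
    ~-reflexive {u} u≈v = resp-≈ (trans (sym (inverseˡ u)) (∙-congˡ u≈v)) unit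

    ~-sym : ∀ {u v} → u ~ v → v ~ u
    ~-sym {u} {v} u~v =
      resp-≈ (trans (⁻¹-anti-homo-∙ (u ⁻¹) v) (∙-congˡ (⁻¹-involutive u))) (inv u~v)

    ~-trans : ∀ {u v w} → u ~ v → v ~ w → u ~ w
    ~-trans {u} {v} {w} u~v v~w =
      resp-≈ (trans (assoc (u ⁻¹) v (v ⁻¹ ∙ w)) (∙-congˡ (cancelˡ-⁻¹ v w))) (mul u~v v~w)

    ~-x^ : ∀ u n → u ~ u ∙ x^ n
    ~-x^ u n = resp-≈ (sym (cancel-⁻¹ˡ u (x^ n))) (x^∈⟨x⟩ n)

    -- Treats infinite order and finite order at least L alike.
    DistinctPowers : ℕ → Set _
    DistinctPowers L = ∀ {i j} → i < L → j < L → x^ i ≈ x^ j → i ≡ j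

    -- A pair (s , d) stands for the two generators s and s x^d.
    elements : List (Carrier × ℕ) → List Carrier
    elements []            = []
    elements ((s , d) ∷ C) = s ∙ x^ d ∷ s ∷ elements C

    length-elements : ∀ C → length (elements C) ≡ length C ℕ.+ length C
    length-elements []      = ≡.refl
    length-elements (_ ∷ C) =
      ≡.cong suc (≡.trans (≡.cong suc (length-elements C)) (≡.sym (ℕ.+-suc _ _)))

    -- Recording the member of the pair by its exponent, 0 or d, reduces comparisons of elements to
    -- additions of exponents.
    element : ∀ C {v} → v ∈ elements C →
              ∃₂ λ s d → (s , d) ∈ₚ C × ∃ λ a → (a ≡ 0 ⊎ a ≡ d) × v ≈ s ∙ x^ a
    element ((s , d) ∷ _) (here v≈)         = s , d , here ≡.refl , d , inj₂ ≡.refl , v≈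
    element ((s , d) ∷ _) (there (here v≈)) =
      s , d , here ≡.refl , 0 , inj₁ ≡.refl , trans v≈ (sym (identityʳ s))
    element (_ ∷ C) (there (there v∈)) with element C v∈
    ... | s , d , p , rest = s , d , there p , rest

    base∈ : ∀ {C s d} → (s , d) ∈ₚ C → s ∈ elements C
    base∈ (here ≡.refl) = there (here refl)
    base∈ (there p)     = there (there (base∈ p))

    shift∈ : ∀ {C s d} → (s , d) ∈ₚ C → s ∙ x^ d ∈ elements C
    shift∈ (here ≡.refl) = here refl
    shift∈ (there p)     = there (there (shift∈ p))

    -- Each coset and each distance determines its pair. Positivity keeps the two members of a pair
    -- apart.
    record Separated (D : ℕ) (C : List (Carrier × ℕ)) : Set (c Level.⊔ ℓ) where
      field
        outside   : ∀ {s d} → (s , d) ∈ₚ C → ¬ ⟨x⟩ s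
        positive  : ∀ {s d} → (s , d) ∈ₚ C → 0 < d
        bounded   : ∀ {s d} → (s , d) ∈ₚ C → d < D
        cosets    : ∀ {p q} → p ∈ₚ C → q ∈ₚ C → proj₁ p ~ proj₁ q → p ≡ q
        distances : ∀ {p q} → p ∈ₚ C → q ∈ₚ C → proj₂ p ≡ proj₂ q → p ≡ q

    element∉⟨x⟩ : ∀ {D C v} → Separated D C → v ∈ elements C → ¬ ⟨x⟩ v
    element∉⟨x⟩ {C = C} sep v∈E v∈⟨x⟩ with element C v∈E
    ... | s , d , p , a , _ , v≈ = Separated.outside sep p (cancelʳ-∈ (x^∈⟨x⟩ a) (resp-≈ v≈ v∈⟨x⟩))

    -- The shift of the exponent by one leaves out x^0 = ε.
    generators : ℕ → List (Carrier × ℕ) → List Carrier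
    generators M C = applyUpTo (λ i → x^ suc i) M ++ elements C

    power∈ : ∀ M C {i} → i < M → x^ suc i ∈ generators M C
    power∈ M C i<M = Membershipₚ.∈-++⁺ˡ setoid (Membershipₚ.∈-applyUpTo⁺ setoid (λ i → x^ suc i) i<M)

    element∈ : ∀ M C {v} → v ∈ elements C → v ∈ generators M C
    element∈ M C v∈ = Membershipₚ.∈-++⁺ʳ setoid (applyUpTo (λ i → x^ suc i) M) v∈

    generator : ∀ M C {v} → v ∈ generators M C → (∃ λ i → i < M × v ≈ x^ suc i) ⊎ v ∈ elements C
    generator M C v∈ with Membershipₚ.∈-++⁻ setoid (applyUpTo (λ i → x^ suc i) M) v∈
    ... | inj₁ v∈powers = inj₁ (Membershipₚ.∈-applyUpTo⁻ setoid (λ i → x^ suc i) v∈powers)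
    ... | inj₂ v∈C      = inj₂ v∈C

    -- Automorphisms preserve the colours x and s.

    module Rigidity {D C} (sep : Separated D C) (μ L : ℕ)
                    (x^-inj : DistinctPowers L) (M²<L : suc μ * suc μ < L) (2D<L : D ℕ.+ D < L)
                    (2E<μ : length (elements C) ℕ.+ length (elements C) < μ)
                    (φ : Carrier → Carrier) (φ-cong : ∀ {u v} → u ≈ v → φ u ≈ φ v)
                    (φ-inj : ∀ {u v} → φ u ≈ φ v → u ≈ v)
                    (φ-arc : ∀ g {t} → t ∈ generators (suc μ) C →
                      ∃ λ t′ → t′ ∈ generators (suc μ) C × φ (g ∙ t) ≈ φ g ∙ t′)
                    where
      open Separated sep

      private
        M : ℕ
        M = suc μ
        E T : List Carrier
        E = elements C
        T = generators M C

      pow-of-⟨x⟩ : ∀ {v} → v ∈ T → ⟨x⟩ v → ∃ λ i → i < M × v ≈ x^ suc i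
      pow-of-⟨x⟩ v∈T v∈⟨x⟩ with generator M C v∈T
      ... | inj₁ pow = pow
      ... | inj₂ v∈E = contradiction v∈⟨x⟩ (element∉⟨x⟩ sep v∈E)

      -- The arc from g to g x has the μ common out-neighbours g x², …, g x^M,
      -- while an arc coloured by t ∉ ⟨x⟩ has at most 2 |E|: in g u = g t v with
      -- u, v ∈ T one of u, v must lie in E.
      φ-x-power : ∀ g → ∃ λ l → l < M × φ (g ∙ x) ≈ φ g ∙ x^ suc l
      φ-x-power g with φ-arc g (Membershipₚ.∈-resp-≈ setoid (identityʳ x) (power∈ M C (s≤s z≤n)))
      ... | t , t∈T , φgx≈ with generator M C t∈T
      ...   | inj₁ (l , l<M , t≈) = l , l<M , trans φgx≈ (∙-congˡ t≈)
      ...   | inj₂ t∈E = contradiction (common-inj φi≈φj) (Fin.<⇒≢ i<j)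
        where
        common : Fin μ → Carrier
        common i = g ∙ x^ suc (suc (toℕ i))

        candidates : List Carrier
        candidates = map (φ g ∙_) E ++ map ((φ g ∙ t) ∙_) E

        few : length candidates < μ
        few = ≡.subst (_< μ) (≡.sym (≡.trans (List.length-++ (map (φ g ∙_) E))
                (≡.cong₂ ℕ._+_ (List.length-map (φ g ∙_) E) (List.length-map ((φ g ∙ t) ∙_) E)))) 2E<μ

        common∈ : ∀ i → φ (common i) ∈ candidates
        common∈ i
          with φ-arc g (power∈ M C {suc (toℕ i)} (s≤s (Fin.toℕ<n i)))
             | φ-arc (g ∙ x) (power∈ M C {toℕ i} (ℕ.m<n⇒m<1+n (Fin.toℕ<n i)))
        ... | u , u∈T , φ≈u | v , v∈T , φ≈v
          with generator M C u∈T | generator M C v∈T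
        ...   | inj₂ u∈E | _ = Membershipₚ.∈-++⁺ˡ setoid
                (Membershipₚ.∈-resp-≈ setoid (sym φ≈u) (Membershipₚ.∈-map⁺ setoid setoid ∙-congˡ u∈E))
        ...   | inj₁ _ | inj₂ v∈E = Membershipₚ.∈-++⁺ʳ setoid (map (φ g ∙_) E)
                (Membershipₚ.∈-resp-≈ setoid (sym (trans (φ-cong (sym (assoc g x _))) (trans φ≈v (∙-congʳ φgx≈))))
                  (Membershipₚ.∈-map⁺ setoid setoid ∙-congˡ v∈E))
        -- If u and v were both powers of x, then u = t v would put t into ⟨ x ⟩.
        ...   | inj₁ (a , _ , u≈) | inj₁ (b , _ , v≈) =
                contradiction (cancelʳ-∈ (x^∈⟨x⟩ (suc b)) (resp-≈ u≈tv (x^∈⟨x⟩ (suc a)))) (element∉⟨x⟩ sep t∈E)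
          where
          u≈tv : x^ suc a ≈ t ∙ x^ suc b
          u≈tv = ∙-cancelˡ (φ g) _ _ (begin
            φ g ∙ x^ suc a               ≈⟨ ∙-congˡ u≈ ⟨
            φ g ∙ u                      ≈⟨ φ≈u ⟨
            φ (common i)                 ≈⟨ φ-cong (assoc g x _) ⟨
            φ ((g ∙ x) ∙ x^ suc (toℕ i)) ≈⟨ φ≈v ⟩
            φ (g ∙ x) ∙ v                ≈⟨ ∙-cong φgx≈ v≈ ⟩
            (φ g ∙ t) ∙ x^ suc b         ≈⟨ assoc (φ g) t _ ⟩
            φ g ∙ (t ∙ x^ suc b)         ∎)

        collision : ∃₂ λ i j → i Fin.< j × φ (common i) ≈ φ (common j)
        collision = pigeonhole-∈ setoid few (φ ∘ common) common∈
        i j : Fin μ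
        i = proj₁ collision
        j = proj₁ (proj₂ collision)
        i<j : i Fin.< j
        i<j = proj₁ (proj₂ (proj₂ collision))
        φi≈φj : φ (common i) ≈ φ (common j)
        φi≈φj = proj₂ (proj₂ (proj₂ collision))

        small : ∀ (i : Fin μ) → suc (suc (toℕ i)) < L
        small i = ℕ.≤-<-trans (ℕ.≤-trans (s≤s (Fin.toℕ<n i)) (ℕ.m≤m*n M M)) M²<L

        common-inj : ∀ {i j} → φ (common i) ≈ φ (common j) → i ≡ j
        common-inj {i} {j} eq = Fin.toℕ-injective (ℕ.suc-injective (ℕ.suc-injective
          (x^-inj (small i) (small j) (∙-cancelˡ g _ _ (φ-inj eq)))))

      -- Each arc of the path contributes an exponent between 1 and M. The lower bound forces the
      -- exponents to be 1 in `φ-x`; the upper one keeps their sum in the range of distinct powers.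
      φ-x-path : ∀ g i → ∃ λ e → i ≤ e × e ≤ i * M × φ (g ∙ x^ i) ≈ φ g ∙ x^ e
      φ-x-path g zero = zero , z≤n , z≤n , trans (φ-cong (identityʳ g)) (sym (identityʳ (φ g)))
      φ-x-path g (suc i) with φ-x-power g | φ-x-path (g ∙ x) i
      ... | l , l<M , φ≈l | e , i≤e , e≤iM , φ≈e =
        suc l ℕ.+ e , s≤s (ℕ.≤-trans i≤e (ℕ.m≤n+m e l)) , ℕ.+-mono-≤ l<M e≤iM , (begin
          φ (g ∙ (x ∙ x^ i))      ≈⟨ φ-cong (assoc g x (x^ i)) ⟨
          φ ((g ∙ x) ∙ x^ i)      ≈⟨ φ≈e ⟩
          φ (g ∙ x) ∙ x^ e        ≈⟨ ∙-congʳ φ≈l ⟩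
          (φ g ∙ x^ suc l) ∙ x^ e ≈⟨ assoc (φ g) (x^ suc l) (x^ e) ⟩
          φ g ∙ (x^ suc l ∙ x^ e) ≈⟨ ∙-congˡ (x^-homo (suc l) e) ⟨
          φ g ∙ x^ (suc l ℕ.+ e)  ∎)

      -- The image of g x^M is reached from φ g both along the image of the path and by the image of
      -- the closing arc.
      endpoint : ∀ {g t} l e → φ (g ∙ x) ≈ φ g ∙ x^ l → φ ((g ∙ x) ∙ x^ μ) ≈ φ (g ∙ x) ∙ x^ e →
                 φ (g ∙ x^ M) ≈ φ g ∙ t → x^ (l ℕ.+ e) ≈ t
      endpoint {g} {t} l e φ≈l φ≈e φ≈t = ∙-cancelˡ (φ g) _ _ (begin
        φ g ∙ x^ (l ℕ.+ e)  ≈⟨ ∙-congˡ (x^-homo l e) ⟩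
        φ g ∙ (x^ l ∙ x^ e) ≈⟨ assoc (φ g) (x^ l) (x^ e) ⟨
        (φ g ∙ x^ l) ∙ x^ e ≈⟨ ∙-congʳ φ≈l ⟨
        φ (g ∙ x) ∙ x^ e    ≈⟨ φ≈e ⟨
        φ ((g ∙ x) ∙ x^ μ)  ≈⟨ φ-cong (assoc g x (x^ μ)) ⟩
        φ (g ∙ x^ M)        ≈⟨ φ≈t ⟩
        φ g ∙ t             ∎)

      -- The M arcs of the path g, g x, …, g x^M map to powers of x whose exponents
      -- add up to that of the image of the arc from g to g x^M, hence to at most M:
      -- each of them is 1.
      φ-x : ∀ g → φ (g ∙ x) ≈ φ g ∙ x
      φ-x g with φ-x-power g | φ-x-path (g ∙ x) μ | φ-arc g (power∈ M C {μ} ℕ.≤-refl)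
      ... | l , l<M , φ≈l | e , μ≤e , e≤μM , φ≈e | t , t∈T , φ≈t
        with pow-of-⟨x⟩ t∈T (resp-≈ (endpoint (suc l) e φ≈l φ≈e φ≈t) (x^∈⟨x⟩ (suc l ℕ.+ e)))
      ...   | m , m<M , t≈ = trans φ≈l (∙-congˡ (trans (reflexive (≡.cong (λ k → x^ suc k) l≡0)) (identityʳ x)))
        where
        sum≡ : suc l ℕ.+ e ≡ suc m
        sum≡ = x^-inj (ℕ.≤-<-trans (ℕ.+-mono-≤ l<M e≤μM) M²<L)
          (ℕ.≤-<-trans (ℕ.≤-trans m<M (ℕ.m≤m*n M M)) M²<L) (trans (endpoint (suc l) e φ≈l φ≈e φ≈t) t≈)
        -- From suc l + e = suc m one gets l + e = m ≤ μ ≤ e.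
        l≡0 : l ≡ 0
        l≡0 = ℕ.n≤0⇒n≡0 (ℕ.+-cancelʳ-≤ e l 0
          (ℕ.≤-trans (ℕ.≤-reflexive (ℕ.suc-injective sum≡)) (ℕ.≤-trans (ℕ.≤-pred m<M) μ≤e)))

      φ-x^ : ∀ g n → φ (g ∙ x^ n) ≈ φ g ∙ x^ n
      φ-x^ g zero    = trans (φ-cong (identityʳ g)) (sym (identityʳ (φ g)))
      φ-x^ g (suc n) = begin
        φ (g ∙ (x ∙ x^ n)) ≈⟨ φ-cong (assoc g x (x^ n)) ⟨
        φ ((g ∙ x) ∙ x^ n) ≈⟨ φ-x^ (g ∙ x) n ⟩
        φ (g ∙ x) ∙ x^ n   ≈⟨ ∙-congʳ (φ-x g) ⟩
        (φ g ∙ x) ∙ x^ n   ≈⟨ assoc (φ g) x (x^ n) ⟩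
        φ g ∙ (x ∙ x^ n)   ∎

      -- Were the image colour a power of x, φ (g t) would equal φ (g x^(i+1)), and injectivity
      -- would make t itself a power of x.
      φ-element : ∀ g {t} → t ∈ E → ∃ λ v → v ∈ E × φ (g ∙ t) ≈ φ g ∙ v
      φ-element g {t} t∈E with φ-arc g (element∈ M C t∈E)
      ... | v , v∈T , φ≈v with generator M C v∈T
      ...   | inj₂ v∈E = v , v∈E , φ≈v
      ...   | inj₁ (i , _ , v≈) = contradiction (resp-≈ (sym t≈) (x^∈⟨x⟩ (suc i))) (element∉⟨x⟩ sep t∈E)
        where
        t≈ : t ≈ x^ suc i
        t≈ = ∙-cancelˡ g _ _ (φ-inj (trans φ≈v (trans (∙-congˡ v≈) (sym (φ-x^ g (suc i))))))

      -- The two arcs g → g s and g → g s x^d go to arcs with the same difference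
      -- x^d, and this difference determines the pair (s , d).
      match : ∀ {s d v w} → (s , d) ∈ₚ C → v ∈ E → w ∈ E → w ≈ v ∙ x^ d → v ≈ s
      match {s} {d} {v} {w} p v∈E w∈E w≈vx^d with element C v∈E | element C w∈E
      ... | s₁ , d₁ , q₁ , a , a≡ , v≈ | s₂ , d₂ , q₂ , b , b≡ , w≈
        with cosets q₁ q₂ (~-trans (~-x^ s₁ a) (~-trans (~-reflexive (sym v≈)) (~-trans (~-x^ v d)
               (~-trans (~-reflexive (trans (sym w≈vx^d) w≈)) (~-sym (~-x^ s₂ b))))))
      ...   | ≡.refl = conclude a≡ b≡
        where
        bound : ∀ {a} → a ≡ 0 ⊎ a ≡ d₁ → a < D
        bound (inj₁ ≡.refl) = ℕ.≤-<-trans z≤n (bounded p)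
        bound (inj₂ ≡.refl) = bounded q₁

        a+d≡b : a ℕ.+ d ≡ b
        a+d≡b = x^-inj (ℕ.<-trans (ℕ.+-mono-< (bound a≡) (bounded p)) 2D<L)
          (ℕ.<-trans (bound b≡) (ℕ.≤-<-trans (ℕ.m≤m+n D D) 2D<L))
          (∙-cancelˡ s₁ _ _ (begin
            s₁ ∙ x^ (a ℕ.+ d)     ≈⟨ ∙-congˡ (x^-homo a d) ⟩
            s₁ ∙ (x^ a ∙ x^ d)    ≈⟨ assoc s₁ (x^ a) (x^ d) ⟨
            (s₁ ∙ x^ a) ∙ x^ d    ≈⟨ ∙-congʳ v≈ ⟨
            v ∙ x^ d              ≈⟨ w≈vx^d ⟨
            w                     ≈⟨ w≈ ⟩
            s₁ ∙ x^ b             ∎))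

        d≢0 : d ≡ 0 → v ≈ s
        d≢0 d≡0 = contradiction (≡.sym d≡0) (ℕ.<⇒≢ (positive p))

        -- The equation a + d = b with d > 0 leaves only a = 0 and b = d₁. Then d = d₁, so both
        -- pairs coincide and v = s.
        conclude : a ≡ 0 ⊎ a ≡ d₁ → b ≡ 0 ⊎ b ≡ d₁ → v ≈ s
        conclude _             (inj₁ ≡.refl) = d≢0 (ℕ.m+n≡0⇒n≡0 a a+d≡b)
        conclude (inj₁ ≡.refl) (inj₂ ≡.refl) with distances p q₁ a+d≡b
        ... | ≡.refl = trans v≈ (identityʳ s)
        conclude (inj₂ ≡.refl) (inj₂ ≡.refl) =
          d≢0 (ℕ.+-cancelˡ-≡ a d 0 (≡.trans a+d≡b (≡.sym (ℕ.+-identityʳ a))))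

      φ-base : ∀ {s d} → (s , d) ∈ₚ C → ∀ g → φ (g ∙ s) ≈ φ g ∙ s
      φ-base {s} {d} p g with φ-element g (base∈ p) | φ-element g (shift∈ p)
      ... | v , v∈E , φ≈v | w , w∈E , φ≈w = trans φ≈v (∙-congˡ (match p v∈E w∈E (∙-cancelˡ (φ g) _ _ (begin
        φ g ∙ w            ≈⟨ φ≈w ⟨
        φ (g ∙ (s ∙ x^ d)) ≈⟨ φ-cong (assoc g s (x^ d)) ⟨
        φ ((g ∙ s) ∙ x^ d) ≈⟨ φ-x^ (g ∙ s) d ⟩
        φ (g ∙ s) ∙ x^ d   ≈⟨ ∙-congʳ φ≈v ⟩
        (φ g ∙ v) ∙ x^ d   ≈⟨ assoc (φ g) v (x^ d) ⟩
        φ g ∙ (v ∙ x^ d)   ∎))))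

    -- Greedy choice of pairs without mutually inverse elements.

    -- Involutions are allowed here; where they must be avoided, the predicate Q of `Greedy`
    -- excludes them.
    NoInversePairs : List Carrier → Set _
    NoInversePairs E = ∀ {u v} → u ∈ E → v ∈ E → u ∙ v ≈ ε → u ≈ v

    noInversePairs-∷ : ∀ {u E} → ¬ u ∈ map _⁻¹ E → NoInversePairs E → NoInversePairs (u ∷ E)
    noInversePairs-∷ {u} {E} u∉E⁻¹ nip = nip′
      where
      not-inverse : ∀ {v w} → v ≈ u → w ∈ E → ¬ (v ∙ w ≈ ε)
      not-inverse {v} {w} v≈u w∈E vw≈ε = u∉E⁻¹ (Membershipₚ.∈-resp-≈ setoid
        (trans (sym (inverseˡ-unique v w vw≈ε)) v≈u) (Membershipₚ.∈-map⁺ setoid setoid ⁻¹-cong w∈E))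

      nip′ : NoInversePairs (u ∷ E)
      nip′ (here v≈u)  (here w≈u)  vw≈ε = trans v≈u (sym w≈u)
      nip′ (here v≈u)  (there w∈E) vw≈ε = contradiction vw≈ε (not-inverse v≈u w∈E)
      nip′ (there v∈E) (here w≈u)  vw≈ε = contradiction (inverse-comm vw≈ε) (not-inverse w≈u v∈E)
      nip′ (there v∈E) (there w∈E) vw≈ε = nip v∈E w∈E vw≈ε

    module Greedy (em : ∀ {a} → ExcludedMiddle a) {q} (Q : Pred Carrier q)
                  (Q-resp : ∀ {u v} → u ≈ v → Q u → Q v) (m : ℕ)
                  (x^-inj : DistinctPowers (m ℕ.+ m)) where

      -- Weak enough for `NonInvolution`, where Q may fail at every other element of the coset.
      Eligible : Pred Carrier _
      Eligible u = ∀ a → Q (u ∙ x^ a) ⊎ Q (u ∙ x^ suc a)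

      eligible-x^ : ∀ {u} a → Eligible u → Eligible (u ∙ x^ a)
      eligible-x^ {u} a el b =
        Sum.map (Q-resp (shifted b)) (Q-resp (trans (reflexive (≡.cong (λ k → u ∙ x^ k) (≡.sym (ℕ.+-suc a b))))
          (shifted (suc b)))) (el (a ℕ.+ b))
        where
        shifted : ∀ b → u ∙ x^ (a ℕ.+ b) ≈ (u ∙ x^ a) ∙ x^ b
        shifted b = trans (∙-congˡ (x^-homo a b)) (sym (assoc u (x^ a) (x^ b)))

      -- One exponent is chosen from each block 2k, 2k + 1. Halving recovers k, so different blocks
      -- give different exponents.
      exponent : ∀ {u} → Eligible u → ∀ k → ∃ λ a → a < suc (suc (k ℕ.+ k)) × ⌊ a /2⌋ ≡ k × Q (u ∙ x^ a)
      exponent el k with el (k ℕ.+ k)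
      ... | inj₁ Qux^a = k ℕ.+ k , s≤s (ℕ.n≤1+n _) , ≡.sym (ℕ.n≡⌊n+n/2⌋ k) , Qux^a
      ... | inj₂ Qux^a = suc (k ℕ.+ k) , ℕ.≤-refl , ≡.sym (ℕ.n≡⌈n+n/2⌉ k) , Qux^a

      exponent< : ∀ {u} (el : Eligible u) {k} → k < m → proj₁ (exponent el k) < m ℕ.+ m
      exponent< el {k} k<m = ℕ.≤-trans (proj₁ (proj₂ (exponent el k)))
        (≡.subst (_≤ m ℕ.+ m) (≡.cong suc (ℕ.+-suc k k)) (ℕ.+-mono-≤ k<m k<m))

      abstract
        -- The m blocks give m distinct elements satisfying Q, more than F can contain.
        pick : ∀ {u} F → length F < m → Eligible u →
               ∃ λ a → a < m ℕ.+ m × Q (u ∙ x^ a) × ¬ u ∙ x^ a ∈ F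
        pick {u} F F<m el with escape setoid em F F<m (λ k → u ∙ x^ proj₁ (exponent el k)) candidates-inj
          where
          candidates-inj : ∀ {i j} → i < m → j < m →
            u ∙ x^ proj₁ (exponent el i) ≈ u ∙ x^ proj₁ (exponent el j) → i ≡ j
          candidates-inj {i} {j} i<m j<m eq = ≡.trans (≡.sym (half i)) (≡.trans
            (≡.cong ⌊_/2⌋ (x^-inj (exponent< el i<m) (exponent< el j<m) (∙-cancelˡ u _ _ eq))) (half j))
            where
            half : ∀ k → ⌊ proj₁ (exponent el k) /2⌋ ≡ k
            half k = proj₁ (proj₂ (proj₂ (exponent el k)))
        ... | k , k<m , ∉F = proj₁ (exponent el k) , exponent< el k<m ,
          proj₂ (proj₂ (proj₂ (exponent el k))) , ∉F

      -- A covered element already lies in the subgroup generated by x and the bases s, so it gets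
      -- no pair of its own.
      Covered : List (Carrier × ℕ) → Carrier → Set _
      Covered C u = ⟨x⟩ u ⊎ ∃₂ λ s d → (s , d) ∈ₚ C × s ~ u

      covered-resp : ∀ {C u v} → u ≈ v → Covered C u → Covered C v
      covered-resp u≈v = Sum.map (resp-≈ u≈v)
        (λ (s , d , p , s~u) → s , d , p , ~-trans s~u (~-reflexive u≈v))

      -- Every new distance comes from the next window of length 2m, whence the bound in
      -- `separated`.
      record Selection (ts : List Carrier) : Set (c Level.⊔ ℓ Level.⊔ q) where
        field
          pairs          : List (Carrier × ℕ)
          short          : length pairs ≤ length ts
          separated      : Separated (suc (length ts * (m ℕ.+ m))) pairs
          covers         : ∀ {t} → t ∈ ts → Covered pairs t
          satisfies      : ∀ {v} → v ∈ elements pairs → Q v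
          noInversePairs : NoInversePairs (elements pairs)

      separated-mono : ∀ {D D′ C} → D ≤ D′ → Separated D C → Separated D′ C
      separated-mono D≤D′ sep = record
        { outside = outside ; positive = positive ; bounded = λ p → ℕ.≤-trans (bounded p) D≤D′
        ; cosets = cosets ; distances = distances }
        where open Separated sep

      -- All earlier distances lie below D ≤ d, so the new one differs from them.
      separated-∷ : ∀ {D D′ C s d} → Separated D C → 0 < D → D ≤ d → d < D′ → ¬ ⟨x⟩ s →
                    (∀ {s′ d′} → (s′ , d′) ∈ₚ C → ¬ s′ ~ s) → Separated D′ ((s , d) ∷ C)
      separated-∷ {D} {D′} {C} {s} {d} sep 0<D D≤d d<D′ s∉⟨x⟩ new = record
        { outside   = λ { (here ≡.refl) → s∉⟨x⟩ ; (there p) → outside p }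
        ; positive  = λ { (here ≡.refl) → ℕ.≤-trans 0<D D≤d ; (there p) → positive p }
        ; bounded   = λ { (here ≡.refl) → d<D′ ; (there p) → ℕ.<-trans (below p) d<D′ }
        ; cosets    = λ { (here ≡.refl) (here ≡.refl) _ → ≡.refl
                        ; (here ≡.refl) (there q) s~ → contradiction (~-sym s~) (new q)
                        ; (there p) (here ≡.refl) ~s → contradiction ~s (new p)
                        ; (there p) (there q) ~ → cosets p q ~ }
        ; distances = λ { (here ≡.refl) (here ≡.refl) _ → ≡.refl
                        ; (here ≡.refl) (there q) eq → contradiction (≡.sym eq) (ℕ.<⇒≢ (below q))
                        ; (there p) (here ≡.refl) eq → contradiction eq (ℕ.<⇒≢ (below p))
                        ; (there p) (there q) eq → distances p q eq }
        }
        where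
        open Separated sep
        below : ∀ {s′ d′} → (s′ , d′) ∈ₚ C → d′ < d
        below p = ℕ.≤-trans (bounded p) D≤d

      skip : ∀ {t ts} (S : Selection ts) → Covered (Selection.pairs S) t → Selection (t ∷ ts)
      skip S t-covered = record
        { pairs = pairs ; short = ℕ.m≤n⇒m≤1+n short
        ; separated = separated-mono (s≤s (ℕ.m≤n+m _ _)) separated
        ; covers = λ { (here t′≈t) → covered-resp (sym t′≈t) t-covered ; (there t∈ts) → covers t∈ts }
        ; satisfies = satisfies ; noInversePairs = noInversePairs }
        where open Selection S

      add : ∀ {t ts} (S : Selection ts) → Eligible t → suc (suc (length ts ℕ.+ length ts)) ≤ m →
            ¬ Covered (Selection.pairs S) t → Selection (t ∷ ts)
      add {t} {ts} S eligible 2n+2≤m uncovered = record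
        { pairs = (s , d) ∷ pairs ; short = s≤s short
        ; separated = separated-∷ separated (s≤s z≤n) (ℕ.m≤m+n D b)
            (≡.subst (λ k → d < suc k) (ℕ.+-comm (n * (m ℕ.+ m)) (m ℕ.+ m)) (ℕ.+-monoʳ-< D b<))
            (λ s∈⟨x⟩ → uncovered (inj₁ (cancelʳ-∈ (x^∈⟨x⟩ a) s∈⟨x⟩)))
            (λ p s′~s → uncovered (inj₂ (_ , _ , p , ~-trans s′~s (~-sym (~-x^ t a)))))
        ; covers = λ { (here t′≈t) → covered-resp (sym t′≈t) (inj₂ (s , d , here ≡.refl , ~-sym (~-x^ t a)))
                     ; (there t∈ts) → Sum.map₂ (λ (s , d , p , s~t) → s , d , there p , s~t) (covers t∈ts) }
        ; satisfies = λ { (here v≈) → Q-resp (trans (sym sx^d≈) (sym v≈)) (proj₁ (proj₂ (proj₂ second)))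
                        ; (there (here v≈)) → Q-resp (sym v≈) (proj₁ (proj₂ (proj₂ first)))
                        ; (there (there v∈)) → satisfies v∈ }
        ; noInversePairs = noInversePairs-∷
            (proj₂ (proj₂ (proj₂ second)) ∘ Membershipₚ.∈-resp-≈ setoid sx^d≈)
            (noInversePairs-∷ (proj₂ (proj₂ (proj₂ first))) noInversePairs)
        }
        where
        open Selection S
        n D : ℕ
        n = length ts
        D = suc (n * (m ℕ.+ m))

        inverses : List Carrier
        inverses = map _⁻¹ (elements pairs)
        inverses≤ : length inverses ≤ n ℕ.+ n
        inverses≤ = ≡.subst (_≤ n ℕ.+ n)
          (≡.sym (≡.trans (List.length-map _⁻¹ (elements pairs)) (length-elements pairs))) (ℕ.+-mono-≤ short short)

        -- At most 2n inverses are forbidden here; the second choice must avoid s⁻¹ as well. This is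
        -- where 2n + 2 ≤ m comes from.
        first : ∃ λ a → a < m ℕ.+ m × Q (t ∙ x^ a) × ¬ t ∙ x^ a ∈ inverses
        first = pick inverses (ℕ.≤-trans (s≤s inverses≤) (ℕ.≤-trans (ℕ.n≤1+n _) 2n+2≤m)) eligible
        a : ℕ
        a = proj₁ first
        s : Carrier
        s = t ∙ x^ a

        -- Starting at s x^D makes the distance d = D + b at least D.
        second : ∃ λ b → b < m ℕ.+ m × Q ((s ∙ x^ D) ∙ x^ b) × ¬ (s ∙ x^ D) ∙ x^ b ∈ s ⁻¹ ∷ inverses
        second = pick (s ⁻¹ ∷ inverses) (ℕ.≤-trans (s≤s (s≤s inverses≤)) 2n+2≤m)
          (eligible-x^ D (eligible-x^ a eligible))
        b d : ℕ
        b = proj₁ second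
        d = D ℕ.+ b
        b< : b < m ℕ.+ m
        b< = proj₁ (proj₂ second)
        sx^d≈ : s ∙ x^ d ≈ (s ∙ x^ D) ∙ x^ b
        sx^d≈ = trans (∙-congˡ (x^-homo D b)) (sym (assoc s (x^ D) (x^ b)))

      select : ∀ ts → length ts ℕ.+ length ts ≤ m → (∀ {t} → t ∈ ts → Eligible t) → Selection ts
      select [] _ _ = record
        { pairs = [] ; short = z≤n
        ; separated = record { outside = λ () ; positive = λ () ; bounded = λ () ; cosets = λ () ; distances = λ () }
        ; covers = λ () ; satisfies = λ () ; noInversePairs = λ () }
      select (t ∷ ts) 2ts≤m eligible
        with select ts (ℕ.≤-trans (ℕ.+-mono-≤ (ℕ.n≤1+n _) (ℕ.n≤1+n _)) 2ts≤m) (eligible ∘ there)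
      ... | S with em {P = Covered (Selection.pairs S) t}
      ...   | yes covered   = skip S covered
      ...   | no  uncovered =
        add S (eligible (here refl)) (≡.subst (λ k → suc k ≤ m) (ℕ.+-suc (length ts) (length ts)) 2ts≤m) uncovered

  -- Cayley digraphs of finite lists and the rigidity property.

  module _ (em : ∀ {a} → ExcludedMiddle a) where

    finitelyGenerating : ∀ T → (∀ g → span T g) → GeneratingSet G
    finitelyGenerating T generates = record
      { Member = _∈ T ; respects = Membershipₚ.∈-resp-≈ setoid ; generates = generates }

    locallyFinite : ∀ {T} (generates : ∀ g → span T g) ε∉T →
                    LocallyFinite (cayleyDigraph G (finitelyGenerating T generates) ε∉T)
    locallyFinite {T} _ _ g =
      list⇒Finite setoid em (map (g ∙_) T) (mk⇔
        (λ (s , s∈T , y≈gs) → Membershipₚ.∈-resp-≈ setoid (sym y≈gs) (Membershipₚ.∈-map⁺ setoid setoid ∙-congˡ s∈T))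
        (λ y∈ → Membershipₚ.∈-map⁻ setoid setoid y∈)) ,
      list⇒Finite setoid em (map (λ s → g ∙ s ⁻¹) T) (mk⇔
        (λ (s , s∈T , g≈ys) → Membershipₚ.∈-resp-≈ setoid
          (sym (trans (sym (//-rightDividesʳ s _)) (∙-congʳ (sym g≈ys))))
          (Membershipₚ.∈-map⁺ setoid setoid (λ s≈t → ∙-congˡ (⁻¹-cong s≈t)) s∈T))
        (λ y∈ → let s , s∈T , y≈ = Membershipₚ.∈-map⁻ setoid setoid y∈ in
          s , s∈T , sym (trans (∙-congʳ y≈) (//-rightDividesˡ s g))))

    left-multiplication-isAutomorphism : ∀ (S : GeneratingSet G) ε∉S φ →
      IsLeftMultiplication G φ → IsAutomorphism (cayleyDigraph G S ε∉S) φ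
    left-multiplication-isAutomorphism S ε∉S φ (g , φ≈g) u v = mk⇔
      (λ (s , s∈S , v≈us) → s , s∈S , (begin
        Inverse.to φ v     ≈⟨ φ≈g v ⟩
        g ∙ v              ≈⟨ ∙-congˡ v≈us ⟩
        g ∙ (u ∙ s)        ≈⟨ assoc g u s ⟨
        (g ∙ u) ∙ s        ≈⟨ ∙-congʳ (φ≈g u) ⟨
        Inverse.to φ u ∙ s ∎))
      (λ (s , s∈S , φv≈φus) → s , s∈S , ∙-cancelˡ g _ _ (begin
        g ∙ v              ≈⟨ φ≈g v ⟨
        Inverse.to φ v     ≈⟨ φv≈φus ⟩
        Inverse.to φ u ∙ s ≈⟨ ∙-congʳ (φ≈g u) ⟩
        (g ∙ u) ∙ s        ≈⟨ assoc g u s ⟩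
        g ∙ (u ∙ s)        ∎))

    -- The last clause with Q = NonInvolution excludes bigons.
    Rigid : ∀ {q} → Pred Carrier q → Set _
    Rigid Q = Σ (GeneratingSet G) λ S → Σ (ε ∉ GeneratingSet.Member S) λ ε∉S →
      LocallyFinite (cayleyDigraph G S ε∉S) × AutomorphismsAreLeftMultiplications G S ε∉S ×
      (∀ {u v} → GeneratingSet.Member S u → GeneratingSet.Member S v → u ∙ v ≈ ε → u ≈ v × Q u)

    -- In rank 0 the group is trivial and its digraph is a single vertex without arcs.
    rigid-trivial : ∀ {q} {Q : Pred Carrier q} → (∀ g → span [] g) → Rigid Q
    rigid-trivial generates = finitelyGenerating [] generates , (λ ()) , locallyFinite generates (λ ()) ,
      (λ Φ → mk⇔
        (λ _ → Inverse.to Φ ε , λ u → trans (Inverse.to-cong Φ (sym (identityˡ u)))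
          (commutes-on-generated (Inverse.to-cong Φ) (λ ()) (generates u) ε))
        (left-multiplication-isAutomorphism (finitelyGenerating [] generates) (λ ()) Φ)) ,
      λ ()

    NonInvolution : Pred Carrier ℓ
    NonInvolution u = ¬ (u ∙ u ≈ ε)

    nonInvolution-resp : ∀ {u v} → u ≈ v → NonInvolution u → NonInvolution v
    nonInvolution-resp u≈v u²≉ε v²≈ε = u²≉ε (trans (∙-cong u≈v u≈v) v²≈ε)

    -- The colours s and t of the two arcs of a bigon satisfy s t = ε, so s = t would be an
    -- involution.
    withoutBigons : ((S , ε∉S , _) : Rigid NonInvolution) → WithoutBigons (cayleyDigraph G S ε∉S)
    withoutBigons (S , ε∉S , _ , _ , inverse-pairs) u v ((s , s∈S , v≈us) , (t , t∈S , u≈vt)) =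
      let s≈t , s²≉ε = inverse-pairs s∈S t∈S st≈ε in s²≉ε (trans (∙-congˡ s≈t) st≈ε)
      where
      st≈ε : s ∙ t ≈ ε
      st≈ε = ∙-cancelˡ u _ _ (begin
        u ∙ (s ∙ t) ≈⟨ assoc u s t ⟨
        (u ∙ s) ∙ t ≈⟨ ∙-congʳ v≈us ⟨
        v ∙ t       ≈⟨ u≈vt ⟨
        u           ≈⟨ identityʳ u ⟨
        u ∙ ε       ∎)

    -- The rigid generating set built from x and a list of further generators.

    module _ (x : Carrier) {R : ℕ} (x^-inj : Powers.DistinctPowers x (suc (pathLength R * pathLength R)))
             {ts : List Carrier} (ts≤R : length ts ≤ R) (generates : ∀ g → span (x ∷ ts) g)
             {q} {Q : Pred Carrier q} (Q-resp : ∀ {u v} → u ≈ v → Q u → Q v)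
             (Q-powers : ∀ {t} → t ∈ ts → ∀ a → Q (t ∙ pow G x a) ⊎ Q (t ∙ pow G x (suc a))) where
      open Powers x
      private
        K M μ n : ℕ
        K = (R ℕ.+ R) ℕ.+ (R ℕ.+ R)
        M = pathLength R
        μ = suc K
        n = length ts

        M≤M² : M ≤ M * M
        M≤M² = ℕ.m≤m*n M M

        K≤M² : K ≤ suc (M * M)
        K≤M² = ℕ.≤-trans (ℕ.m≤n+m K 2) (ℕ.m≤n⇒m≤1+n M≤M²)

        -- The choice m = 2R meets the requirement 2 |ts| ≤ m of `select`, and the window length 2m
        -- is K.
        open Greedy em Q Q-resp (R ℕ.+ R)
          (λ i<K j<K → x^-inj (ℕ.≤-trans i<K K≤M²) (ℕ.≤-trans j<K K≤M²))
        open Selection (select ts (ℕ.+-mono-≤ ts≤R ts≤R) Q-powers)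

        T : List Carrier
        T = generators M pairs

        D : ℕ
        D = suc (n * K)

        2D<L : D ℕ.+ D < suc (M * M)
        2D<L = s≤s (distance-bound ts≤R)

        few-elements : length (elements pairs) ℕ.+ length (elements pairs) < μ
        few-elements = s≤s (ℕ.+-mono-≤ elements≤ elements≤)
          where
          elements≤ : length (elements pairs) ≤ R ℕ.+ R
          elements≤ = ≡.subst (_≤ R ℕ.+ R) (≡.sym (length-elements pairs))
            (ℕ.+-mono-≤ (ℕ.≤-trans short ts≤R) (ℕ.≤-trans short ts≤R))

        -- These are the colours that `Rigidity` shows to be preserved; since they generate G, the
        -- map φ is determined by φ ε.
        basis : List Carrier
        basis = x ∷ map proj₁ pairs

        basis-generates : ∀ g → span basis g
        basis-generates g = generated-⊆
          (λ { (here y≈x) → gen (here y≈x) ; (there t∈ts) → covered⇒∈ (covers t∈ts) }) (generates g)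
          where
          ⟨x⟩⊆ : ∀ {u} → ⟨x⟩ u → span basis u
          ⟨x⟩⊆ = generated-⊆ (λ { (here y≈x) → gen (here y≈x) })

          covered⇒∈ : ∀ {t} → Covered pairs t → span basis t
          covered⇒∈ (inj₁ t∈⟨x⟩) = ⟨x⟩⊆ t∈⟨x⟩
          covered⇒∈ (inj₂ (s , d , p , s~t)) = resp-≈ (cancelˡ-⁻¹ s _)
            (mul (gen (there (Membershipₚ.∈-map⁺ (≡.setoid _) setoid (λ { ≡.refl → refl }) p))) (⟨x⟩⊆ s~t))

        basis⊆T : ∀ {u} → u ∈ basis → u ∈ T
        basis⊆T (here u≈x) = Membershipₚ.∈-resp-≈ setoid (trans (identityʳ x) (sym u≈x)) (power∈ M pairs (s≤s z≤n))
        basis⊆T (there u∈) with Membershipₚ.∈-map⁻ (≡.setoid _) setoid u∈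
        ... | _ , p , u≈s = Membershipₚ.∈-resp-≈ setoid (sym u≈s) (element∈ M pairs (base∈ p))

        T-generates : ∀ g → span T g
        T-generates g = generated-⊆ (gen ∘ basis⊆T) (basis-generates g)

        S : GeneratingSet G
        S = finitelyGenerating T T-generates

        ε∉T : ¬ ε ∈ T
        ε∉T ε∈T with generator M pairs ε∈T
        ... | inj₁ (i , i<M , ε≈) =
          contradiction (x^-inj (s≤s z≤n) (s≤s (ℕ.≤-trans i<M M≤M²)) ε≈) λ ()
        ... | inj₂ ε∈E = element∉⟨x⟩ separated ε∈E unit

        automorphisms : AutomorphismsAreLeftMultiplications G S ε∉T
        automorphisms Φ = mk⇔ automorphism⇒ (left-multiplication-isAutomorphism S ε∉T Φ)
          where
          φ : Carrier → Carrier
          φ = Inverse.to Φ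

          automorphism⇒ : IsAutomorphism (cayleyDigraph G S ε∉T) Φ → IsLeftMultiplication G Φ
          automorphism⇒ aut = φ ε , λ u → trans (Inverse.to-cong Φ (sym (identityˡ u)))
            (commutes-on-generated (Inverse.to-cong Φ) φ-basis (basis-generates u) ε)
            where
            φ-inj : ∀ {u v} → φ u ≈ φ v → u ≈ v
            φ-inj {u} {v} φu≈φv = trans (sym (Inverse.strictlyInverseʳ Φ u))
              (trans (Inverse.from-cong Φ φu≈φv) (Inverse.strictlyInverseʳ Φ v))

            open Rigidity separated μ (suc (M * M)) x^-inj ℕ.≤-refl 2D<L few-elements
              φ (Inverse.to-cong Φ) φ-inj (λ g t∈T → Equivalence.to (aut g _) (_ , t∈T , refl))

            φ-basis : ∀ {s} → s ∈ basis → ∀ g → φ (g ∙ s) ≈ φ g ∙ s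
            φ-basis (here s≈x) g =
              trans (Inverse.to-cong Φ (∙-congˡ s≈x)) (trans (φ-x g) (∙-congˡ (sym s≈x)))
            φ-basis (there s∈) g with Membershipₚ.∈-map⁻ (≡.setoid _) setoid s∈
            ... | _ , p , s≈ = trans (Inverse.to-cong Φ (∙-congˡ s≈)) (trans (φ-base p g) (∙-congˡ (sym s≈)))

        -- Two of the powers have exponents adding up to at most 2M ≤ M², hence a product other than
        -- ε. The inverse of a power lies in ⟨ x ⟩, which contains no element of a pair.
        inverse-pairs : ∀ {u v} → u ∈ T → v ∈ T → u ∙ v ≈ ε → u ≈ v × Q u
        inverse-pairs u∈T v∈T uv≈ε with generator M pairs u∈T | generator M pairs v∈T
        ... | inj₁ (i , i<M , u≈) | inj₁ (j , j<M , v≈) = contradiction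
          (x^-inj (s≤s (ℕ.≤-trans (ℕ.+-mono-≤ i<M j<M) (ℕ.+-monoʳ-≤ M (ℕ.m≤m+n M (K * M))))) (s≤s z≤n)
            (trans (x^-homo (suc i) (suc j)) (trans (sym (∙-cong u≈ v≈)) uv≈ε))) λ ()
        ... | inj₁ (i , _ , u≈) | inj₂ v∈E = contradiction
          (cancelˡ-∈ (x^∈⟨x⟩ (suc i)) (resp-≈ (trans (sym uv≈ε) (∙-congʳ u≈)) unit)) (element∉⟨x⟩ separated v∈E)
        ... | inj₂ u∈E | inj₁ (j , _ , v≈) = contradiction
          (cancelʳ-∈ (x^∈⟨x⟩ (suc j)) (resp-≈ (trans (sym uv≈ε) (∙-congˡ v≈)) unit)) (element∉⟨x⟩ separated u∈E)
        ... | inj₂ u∈E | inj₂ v∈E = noInversePairs u∈E v∈E uv≈ε , satisfies u∈E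

      rigid : Rigid Q
      rigid = S , ε∉T , locallyFinite T-generates ε∉T , automorphisms , inverse-pairs

    -- Recognition of generalized dihedral groups.

    module Dihedral (ts : List Carrier) (s : Carrier) (s²≈ε : s ∙ s ≈ ε) (s∉A : ¬ span ts s)
                    (reflection : ∀ {u} → span ts u → (s ∙ u) ∙ (s ∙ u) ≈ ε)
                    (A∪sA : ∀ g → span ts g ⊎ span ts (s ∙ g)) where

      invert : ∀ {u} → span ts u → s ∙ u ≈ u ⁻¹ ∙ s
      invert u∈A = involutions⇒inversion s²≈ε (reflection u∈A)

      -- On A, inversion is conjugation by s, hence multiplicative, while inversion always reverses
      -- products.
      A-comm : ∀ {u v} → span ts u → span ts v → u ∙ v ≈ v ∙ u
      A-comm {u} {v} u∈A v∈A = ⁻¹-injective (∙-cancelʳ s _ _ (begin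
        (u ∙ v) ⁻¹ ∙ s    ≈⟨ invert (mul u∈A v∈A) ⟨
        s ∙ (u ∙ v)       ≈⟨ assoc s u v ⟨
        (s ∙ u) ∙ v       ≈⟨ ∙-congʳ (invert u∈A) ⟩
        (u ⁻¹ ∙ s) ∙ v    ≈⟨ assoc (u ⁻¹) s v ⟩
        u ⁻¹ ∙ (s ∙ v)    ≈⟨ ∙-congˡ (invert v∈A) ⟩
        u ⁻¹ ∙ (v ⁻¹ ∙ s) ≈⟨ assoc (u ⁻¹) (v ⁻¹) s ⟨
        (u ⁻¹ ∙ v ⁻¹) ∙ s ≈⟨ ∙-congʳ (⁻¹-anti-homo-∙ v u) ⟨
        (v ∙ u) ⁻¹ ∙ s    ∎))

      -- Membership in span ts lives in level c ⊔ ℓ; passing to the truth value given by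
      -- excluded middle keeps the carrier of the subgroup in level c.
      A : AbelianGroup c ℓ
      A = record
        { Carrier = Σ Carrier λ u → True (em {P = span ts u})
        ; _≈_     = λ (u , _) (v , _) → u ≈ v
        ; _∙_     = λ (u , u∈A) (v , v∈A) → u ∙ v , fromWitness (mul (toWitness u∈A) (toWitness v∈A))
        ; ε       = ε , fromWitness unit
        ; _⁻¹     = λ (u , u∈A) → u ⁻¹ , fromWitness (inv (toWitness u∈A))
        ; isAbelianGroup = record
          { isGroup = record
            { isMonoid = record
              { isSemigroup = record
                { isMagma = record
                  { isEquivalence = record { refl = refl ; sym = sym ; trans = trans }
                  ; ∙-cong = ∙-cong }
                ; assoc = λ (u , _) (v , _) (w , _) → assoc u v w }
              ; identity = (λ (u , _) → identityˡ u) , (λ (u , _) → identityʳ u) }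
            ; inverse = (λ (u , _) → inverseˡ u) , (λ (u , _) → inverseʳ u)
            ; ⁻¹-cong = ⁻¹-cong }
          ; comm = λ (u , u∈A) (v , v∈A) → A-comm (toWitness u∈A) (toWitness v∈A) }
        }

      private
        D : Group c ℓ
        D = generalizedDihedral A

      f : Group.Carrier D → Carrier
      f ((u , _) , 0ℙ) = u
      f ((u , _) , 1ℙ) = u ∙ s

      f-homo : ∀ p q → f (Group._∙_ D p q) ≈ f p ∙ f q
      f-homo (_ , 0ℙ)           (_ , 0ℙ)         = refl
      f-homo ((u , _) , 0ℙ)     ((v , _) , 1ℙ)   = assoc u v s
      f-homo ((u , _) , 1ℙ)     ((v , v∈A) , 0ℙ) = begin
        (u ∙ v ⁻¹) ∙ s ≈⟨ assoc u (v ⁻¹) s ⟩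
        u ∙ (v ⁻¹ ∙ s) ≈⟨ ∙-congˡ (invert (toWitness v∈A)) ⟨
        u ∙ (s ∙ v)    ≈⟨ assoc u s v ⟨
        (u ∙ s) ∙ v    ∎
      f-homo ((u , u∈A) , 1ℙ)   ((v , v∈A) , 1ℙ) = begin
        u ∙ v ⁻¹             ≈⟨ identityʳ _ ⟨
        (u ∙ v ⁻¹) ∙ ε       ≈⟨ ∙-congˡ s²≈ε ⟨
        (u ∙ v ⁻¹) ∙ (s ∙ s) ≈⟨ assoc (u ∙ v ⁻¹) s s ⟨
        ((u ∙ v ⁻¹) ∙ s) ∙ s ≈⟨ ∙-congʳ (f-homo ((u , u∈A) , 1ℙ) ((v , v∈A) , 0ℙ)) ⟩
        ((u ∙ s) ∙ v) ∙ s    ≈⟨ assoc (u ∙ s) v s ⟩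
        (u ∙ s) ∙ (v ∙ s)    ∎

      f-cong : ∀ {p q} → Group._≈_ D p q → f p ≈ f q
      f-cong {_ , 0ℙ} (u≈v , ≡.refl) = u≈v
      f-cong {_ , 1ℙ} (u≈v , ≡.refl) = ∙-congʳ u≈v

      f-⁻¹-homo : ∀ p → f (Group._⁻¹ D p) ≈ f p ⁻¹
      f-⁻¹-homo p = inverseˡ-unique (f (Group._⁻¹ D p)) (f p) (trans (sym (f-homo (Group._⁻¹ D p) p))
        (f-cong {Group._∙_ D (Group._⁻¹ D p) p} {Group.ε D} (Group.inverseˡ D p)))

      f-injective : ∀ {p q} → f p ≈ f q → Group._≈_ D p q
      f-injective {_ , 0ℙ} {_ , 0ℙ} u≈v  = u≈v , ≡.refl
      f-injective {_ , 1ℙ} {_ , 1ℙ} us≈vs = ∙-cancelʳ s _ _ us≈vs , ≡.refl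
      f-injective {(_ , u∈A) , 0ℙ} {(_ , v∈A) , 1ℙ} u≈vs =
        contradiction (cancelˡ-∈ (toWitness v∈A) (resp-≈ u≈vs (toWitness u∈A))) s∉A
      f-injective {(_ , u∈A) , 1ℙ} {(_ , v∈A) , 0ℙ} us≈v =
        contradiction (cancelˡ-∈ (toWitness u∈A) (resp-≈ (sym us≈v) (toWitness v∈A))) s∉A

      -- If s g lies in A, then s inverts it, so (s g)⁻¹ s = s (s g) = g.
      f-surjective : ∀ g → ∃ λ p → ∀ {q} → Group._≈_ D q p → f q ≈ g
      f-surjective g with A∪sA g
      ... | inj₁ g∈A  = p , λ {q} → f-cong {q} {p}
        where
        p : Group.Carrier D
        p = (g , fromWitness g∈A) , 0ℙ
      ... | inj₂ sg∈A = p , λ {q} q≈p → trans (f-cong {q} {p} q≈p) (begin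
        (s ∙ g) ⁻¹ ∙ s ≈⟨ invert sg∈A ⟨
        s ∙ (s ∙ g)    ≈⟨ assoc s s g ⟨
        (s ∙ s) ∙ g    ≈⟨ ∙-congʳ s²≈ε ⟩
        ε ∙ g          ≈⟨ identityˡ g ⟩
        g              ∎)
        where
        p : Group.Carrier D
        p = (_ , fromWitness (inv sg∈A)) , 1ℙ

      isGeneralizedDihedral : IsGeneralizedDihedral G
      isGeneralizedDihedral = A , f , record
        { isGroupMonomorphism = record
          { isGroupHomomorphism = record
            { isMonoidHomomorphism = record
              { isMagmaHomomorphism = record
                { isRelHomomorphism = record { cong = λ {p} → f-cong {p} }
                ; homo = f-homo }
              ; ε-homo = refl }
            ; ⁻¹-homo = f-⁻¹-homo }
          ; injective = λ {p} {q} → f-injective {p} {q} }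
        ; surjective = f-surjective }

    -- Involutions inverting x and their replacement.

    module _ (x : Carrier) where
      open Powers x

      -- Equivalently, u is an involution and conjugation by u inverts x.
      Inverts : Pred Carrier ℓ
      Inverts u = u ∙ u ≈ ε × (u ∙ x) ∙ (u ∙ x) ≈ ε

      inverts-resp : ∀ {u v} → u ≈ v → Inverts u → Inverts v
      inverts-resp u≈v (u²≈ε , ux²≈ε) =
        trans (sym (∙-cong u≈v u≈v)) u²≈ε , trans (sym (∙-cong (∙-congʳ u≈v) (∙-congʳ u≈v))) ux²≈ε

      inverts-x : ∀ {u} → Inverts (u ∙ x) → Inverts u
      inverts-x {u} (w²≈ε , wx²≈ε) = u²≈ε , w²≈ε
        where
        w : Carrier
        w = u ∙ x
        wx≈x⁻¹w : w ∙ x ≈ x ⁻¹ ∙ w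
        wx≈x⁻¹w = involutions⇒inversion w²≈ε wx²≈ε
        -- As w inverts x, u = w x⁻¹ = x w; then u u = (u x) w = w w.
        u≈xw : u ≈ x ∙ w
        u≈xw = ∙-cancelʳ x _ _ (begin
          w              ≈⟨ cancelˡ-⁻¹ x w ⟨
          x ∙ (x ⁻¹ ∙ w) ≈⟨ ∙-congˡ wx≈x⁻¹w ⟨
          x ∙ (w ∙ x)    ≈⟨ assoc x w x ⟨
          (x ∙ w) ∙ x    ∎)
        u²≈ε : u ∙ u ≈ ε
        u²≈ε = begin
          u ∙ u                ≈⟨ ∙-congˡ u≈xw ⟩
          u ∙ (x ∙ w)          ≈⟨ assoc u x w ⟨
          w ∙ w                ≈⟨ w²≈ε ⟩
          ε                    ∎

      inverts-x^ : ∀ {u} a → Inverts (u ∙ x^ a) → Inverts u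
      inverts-x^ zero    = inverts-resp (identityʳ _)
      inverts-x^ (suc a) = inverts-x ∘ inverts-x^ a ∘ inverts-resp (sym (assoc _ x (x^ a)))

      -- Two consecutive involutions u x^a and u x^(a+1) would mean that u x^a inverts x, and then
      -- so would u. This supplies `Eligible` for `NonInvolution`.
      nonInvolution-x^ : ∀ {u} → ¬ Inverts u → ∀ a → NonInvolution (u ∙ x^ a) ⊎ NonInvolution (u ∙ x^ suc a)
      nonInvolution-x^ {u} ¬inv a with em {P = (u ∙ x^ a) ∙ (u ∙ x^ a) ≈ ε}
      ... | no  ≉ε = inj₁ ≉ε
      ... | yes ≈ε = inj₂ λ next≈ε → ¬inv (inverts-x^ a (≈ε , trans (∙-cong next next) next≈ε))
        where
        next : (u ∙ x^ a) ∙ x ≈ u ∙ x^ suc a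
        next = begin
          (u ∙ x^ a) ∙ x     ≈⟨ assoc u (x^ a) x ⟩
          u ∙ (x^ a ∙ x)     ≈⟨ ∙-congˡ (∙-congˡ (identityʳ x)) ⟨
          u ∙ (x^ a ∙ x^ 1)  ≈⟨ ∙-congˡ (x^-homo a 1) ⟨
          u ∙ x^ (a ℕ.+ 1)   ≡⟨ ≡.cong (λ k → u ∙ x^ k) (ℕ.+-comm a 1) ⟩
          u ∙ x^ suc a       ∎

      -- A product of two elements inverting x commutes with x; if it inverted x as well, x would
      -- equal x⁻¹.
      inverts-∙ : ¬ x ∙ x ≈ ε → ∀ {s t} → Inverts s → Inverts t → ¬ Inverts (s ∙ t)
      inverts-∙ x²≉ε {s} {t} (s²≈ε , sx²≈ε) (t²≈ε , tx²≈ε) (st²≈ε , stx²≈ε) = x²≉ε (begin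
        x ∙ x                             ≈⟨ identityˡ _ ⟨
        ε ∙ (x ∙ x)                       ≈⟨ ∙-congʳ st²≈ε ⟨
        (w ∙ w) ∙ (x ∙ x)                 ≈⟨ assoc w w (x ∙ x) ⟩
        w ∙ (w ∙ (x ∙ x))                 ≈⟨ ∙-congˡ (assoc w x x) ⟨
        w ∙ ((w ∙ x) ∙ x)                 ≈⟨ ∙-congˡ (∙-congʳ wx≈xw) ⟩
        w ∙ ((x ∙ w) ∙ x)                 ≈⟨ ∙-congˡ (assoc x w x) ⟩
        w ∙ (x ∙ (w ∙ x))                 ≈⟨ assoc w x (w ∙ x) ⟨
        (w ∙ x) ∙ (w ∙ x)                 ≈⟨ stx²≈ε ⟩
        ε                                 ∎)
        where
        w : Carrier
        w = s ∙ t
        wx≈xw : w ∙ x ≈ x ∙ w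
        wx≈xw = begin
          (s ∙ t) ∙ x          ≈⟨ assoc s t x ⟩
          s ∙ (t ∙ x)          ≈⟨ ∙-congˡ (involutions⇒inversion t²≈ε tx²≈ε) ⟩
          s ∙ (x ⁻¹ ∙ t)       ≈⟨ cancelˡ-⁻¹ x _ ⟨
          x ∙ (x ⁻¹ ∙ (s ∙ (x ⁻¹ ∙ t))) ≈⟨ ∙-congˡ (assoc (x ⁻¹) s (x ⁻¹ ∙ t)) ⟨
          x ∙ ((x ⁻¹ ∙ s) ∙ (x ⁻¹ ∙ t)) ≈⟨ ∙-congˡ (∙-congʳ (involutions⇒inversion s²≈ε sx²≈ε)) ⟨
          x ∙ ((s ∙ x) ∙ (x ⁻¹ ∙ t))    ≈⟨ ∙-congˡ (assoc s x (x ⁻¹ ∙ t)) ⟩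
          x ∙ (s ∙ (x ∙ (x ⁻¹ ∙ t)))    ≈⟨ ∙-congˡ (∙-congˡ (cancelˡ-⁻¹ x t)) ⟩
          x ∙ (s ∙ t)          ∎

      module Straighten (x²≉ε : ¬ x ∙ x ≈ ε) (s : Carrier) (s-inverts : Inverts s) where

        straighten : Carrier → Carrier
        straighten t with em {P = Inverts t}
        ... | yes _ = s ∙ t
        ... | no  _ = t

        straighten-cong : ∀ {t u} → t ≈ u → straighten t ≈ straighten u
        straighten-cong {t} {u} t≈u with em {P = Inverts t} | em {P = Inverts u}
        ... | yes _    | yes _    = ∙-congˡ t≈u
        ... | no _     | no _     = t≈u
        ... | yes ti  | no ¬ti  = contradiction (inverts-resp t≈u ti) ¬ti
        ... | no ¬ti  | yes ti  = contradiction (inverts-resp (sym t≈u) ti) ¬ti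

        straighten-¬inverts : ∀ t → ¬ Inverts (straighten t)
        straighten-¬inverts t with em {P = Inverts t}
        ... | yes ti = inverts-∙ x²≉ε s-inverts ti
        ... | no ¬ti = ¬ti

        straighten-or : ∀ t → straighten t ≈ t ⊎ straighten t ≈ s ∙ t
        straighten-or t with em {P = Inverts t}
        ... | yes _ = inj₂ refl
        ... | no  _ = inj₁ refl

        s∙s∙ : ∀ g → s ∙ (s ∙ g) ≈ g
        s∙s∙ g = trans (sym (assoc s s g)) (trans (∙-congʳ (proj₁ s-inverts)) (identityˡ g))

        -- Otherwise s s = ε would invert x, making x an involution.
        s∉span : ∀ {us} → (∀ {u} → span us u → Inverts (s ∙ u)) → ¬ span us s
        s∉span inv-sA s∈ = x²≉ε (trans (∙-cong (sym (s²x≈x)) (sym s²x≈x)) (proj₂ (inv-sA s∈)))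
          where
          s²x≈x : (s ∙ s) ∙ x ≈ x
          s²x≈x = trans (∙-congʳ (proj₁ s-inverts)) (identityˡ x)

        -- If every element of s A inverts x, then s normalises A = span us, so that A ∪ s A is
        -- a subgroup.
        module _ {us} (inv-sA : ∀ {u} → span us u → Inverts (s ∙ u)) where

          private
            sus≈u⁻¹ : ∀ {u v} → span us u → s ∙ (u ∙ (s ∙ v)) ≈ u ⁻¹ ∙ v
            sus≈u⁻¹ {u} {v} u∈ = begin
              s ∙ (u ∙ (s ∙ v))    ≈⟨ assoc s u (s ∙ v) ⟨
              (s ∙ u) ∙ (s ∙ v)    ≈⟨ ∙-congʳ (involutions⇒inversion (proj₁ s-inverts) (proj₁ (inv-sA u∈))) ⟩
              (u ⁻¹ ∙ s) ∙ (s ∙ v) ≈⟨ assoc (u ⁻¹) s (s ∙ v) ⟩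
              u ⁻¹ ∙ (s ∙ (s ∙ v)) ≈⟨ ∙-congˡ (s∙s∙ v) ⟩
              u ⁻¹ ∙ v             ∎

          split : ∀ {p} {S : Pred Carrier p} → (∀ {t} → S t → span us t ⊎ span us (s ∙ t)) →
                  ∀ {g} → Generated G S g → span us g ⊎ span us (s ∙ g)
          split S-split (gen g∈S) = S-split g∈S
          split S-split unit      = inj₁ unit
          split S-split (mul {g} {h} g∈ h∈) with split S-split g∈ | split S-split h∈
          ... | inj₁ g∈A  | inj₁ h∈A  = inj₁ (mul g∈A h∈A)
          ... | inj₁ g∈A  | inj₂ sh∈A = inj₂ (resp-≈ (begin
            g ⁻¹ ∙ (s ∙ h)          ≈⟨ sus≈u⁻¹ g∈A ⟨
            s ∙ (g ∙ (s ∙ (s ∙ h))) ≈⟨ ∙-congˡ (∙-congˡ (s∙s∙ h)) ⟩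
            s ∙ (g ∙ h)             ∎) (mul (inv g∈A) sh∈A))
          ... | inj₂ sg∈A | inj₁ h∈A  = inj₂ (resp-≈ (assoc s g h) (mul sg∈A h∈A))
          ... | inj₂ sg∈A | inj₂ sh∈A = inj₁ (resp-≈ (begin
            (s ∙ g) ⁻¹ ∙ (s ∙ h)          ≈⟨ sus≈u⁻¹ sg∈A ⟨
            s ∙ ((s ∙ g) ∙ (s ∙ (s ∙ h))) ≈⟨ ∙-congˡ (∙-congˡ (s∙s∙ h)) ⟩
            s ∙ ((s ∙ g) ∙ h)             ≈⟨ ∙-congˡ (assoc s g h) ⟩
            s ∙ (s ∙ (g ∙ h))             ≈⟨ s∙s∙ (g ∙ h) ⟩
            g ∙ h                         ∎) (mul (inv sg∈A) sh∈A))
          split S-split (inv {g} g∈) with split S-split g∈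
          ... | inj₁ g∈A  = inj₁ (inv g∈A)
          -- The element s (s g) = g is an involution by `inv-sA`, so g⁻¹ = g.
          ... | inj₂ sg∈A = inj₂ (resp-≈ (∙-congˡ (inverseˡ-unique g g
            (trans (sym (∙-cong (s∙s∙ g) (s∙s∙ g))) (proj₁ (inv-sA sg∈A))))) sg∈A)
          split S-split (resp-≈ g≈h g∈) = Sum.map (resp-≈ g≈h) (resp-≈ (∙-congˡ g≈h)) (split S-split g∈)

      -- Generators inverting x are multiplied by one of them, s; s itself is then recovered
      -- from an element s u which does not invert x and with u in the span A of the new
      -- generators. If there is no such u, then G = A ⋊ ⟨ s ⟩ is generalized dihedral.
      nonInverting-generators : ¬ x ∙ x ≈ ε → ¬ IsGeneralizedDihedral G →
        ∀ ts → (∀ g → span ts g) → ∃ λ us →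
          length us ≤ suc (length ts) × (∀ g → span us g) × (∀ {u} → u ∈ us → ¬ Inverts u)
      nonInverting-generators x²≉ε ¬dihedral ts generates with em {P = ∃ λ s → s ∈ ts × Inverts s}
      ... | no none = ts , ℕ.n≤1+n _ , generates , λ t∈ts t-inverts → none (_ , t∈ts , t-inverts)
      ... | yes (s , s∈ts , s-inverts) = find-u em
        where
        open Straighten x²≉ε s s-inverts

        us : List Carrier
        us = map straighten ts

        straighten∈ : ∀ {t} → t ∈ ts → straighten t ∈ us
        straighten∈ = Membershipₚ.∈-map⁺ setoid setoid straighten-cong

        us-¬inverts : ∀ {u} → u ∈ us → ¬ Inverts u
        us-¬inverts u∈us u-inverts with Membershipₚ.∈-map⁻ setoid setoid u∈us
        ... | t , _ , u≈ = straighten-¬inverts t (inverts-resp u≈ u-inverts)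

        find-u : Dec (∃ λ u → span us u × ¬ Inverts (s ∙ u)) → ∃ λ us →
          length us ≤ suc (length ts) × (∀ g → span us g) × (∀ {u} → u ∈ us → ¬ Inverts u)
        find-u (yes (u , u∈A , su-¬inverts)) =
          s ∙ u ∷ us , s≤s (ℕ.≤-reflexive (List.length-map straighten ts)) ,
          (λ g → generated-⊆ ts⊆ (generates g)) ,
          λ { (here v≈su) v-inverts → su-¬inverts (inverts-resp v≈su v-inverts)
            ; (there v∈us) → us-¬inverts v∈us }
          where
          us⊆ : ∀ {v} → span us v → span (s ∙ u ∷ us) v
          us⊆ = generated-⊆ (gen ∘ there)
          s∈ : span (s ∙ u ∷ us) s
          s∈ = cancelʳ-∈ (us⊆ u∈A) (gen (here refl))
          ts⊆ : ∀ {t} → t ∈ ts → span (s ∙ u ∷ us) t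
          ts⊆ {t} t∈ts with straighten-or t
          ... | inj₁ ≈t  = resp-≈ ≈t (gen (there (straighten∈ t∈ts)))
          ... | inj₂ ≈st = cancelˡ-∈ s∈ (resp-≈ ≈st (gen (there (straighten∈ t∈ts))))
        find-u (no none) = contradiction
          (Dihedral.isGeneralizedDihedral us s (proj₁ s-inverts) (s∉span inv-sA) (proj₁ ∘ inv-sA)
            (λ g → split inv-sA ts-split (generates g)))
          ¬dihedral
          where
          inv-sA : ∀ {u} → span us u → Inverts (s ∙ u)
          inv-sA {u} u∈A with em {P = Inverts (s ∙ u)}
          ... | yes su-inverts = su-inverts
          ... | no su-¬inverts = contradiction (u , u∈A , su-¬inverts) none

          ts-split : ∀ {t} → t ∈ ts → span us t ⊎ span us (s ∙ t)
          ts-split {t} t∈ts = Sum.map (λ ≈t → resp-≈ ≈t (gen (straighten∈ t∈ts)))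
            (λ ≈st → resp-≈ ≈st (gen (straighten∈ t∈ts))) (straighten-or t)

  -- From the order of x to distinct powers.

  module _ {N L x} (L≤N : L ≤ N) (order : OrderAtLeast G N x) where
    open Powers x

    aperiodic : ∀ {k} → 0 < k → k < L → ¬ x^ k ≈ ε
    aperiodic 0<k k<L x^k≈ε = Sum.[ (λ infinite → infinite _ 0<k x^k≈ε) ,
      (λ (n , (_ , _ , minimal) , N≤n) →
        ℕ.<⇒≱ k<L (ℕ.≤-trans L≤N (ℕ.≤-trans N≤n (minimal _ 0<k x^k≈ε)))) ] order

    increasing⇒distinct : ∀ {i j} → i < j → j < L → ¬ x^ i ≈ x^ j
    increasing⇒distinct {i} {j} i<j j<L x^i≈x^j =
      aperiodic (ℕ.m<n⇒0<n∸m i<j) (ℕ.≤-<-trans (ℕ.m∸n≤m j i) j<L) (∙-cancelˡ (x^ i) _ _ (begin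
        x^ i ∙ x^ (j ℕ.∸ i)   ≈⟨ x^-homo i (j ℕ.∸ i) ⟨
        x^ (i ℕ.+ (j ℕ.∸ i))  ≡⟨ ≡.cong x^_ (ℕ.m+[n∸m]≡n (ℕ.<⇒≤ i<j)) ⟩
        x^ j                  ≈⟨ x^i≈x^j ⟨
        x^ i                  ≈⟨ identityʳ (x^ i) ⟨
        x^ i ∙ ε              ∎))

    distinctPowers : DistinctPowers L
    distinctPowers {i} {j} i<L j<L x^i≈x^j with ℕ.<-cmp i j
    ... | tri< i<j _ _ = contradiction x^i≈x^j (increasing⇒distinct i<j j<L)
    ... | tri≈ _ i≡j _ = i≡j
    ... | tri> _ _ j<i = contradiction (sym x^i≈x^j) (increasing⇒distinct j<i i<L)

  enumeration-generates : ∀ (S : GeneratingSet G) {r} (∣S∣≡r : HasCardinality setoid (GeneratingSet.Member S) r) →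
                          ∀ g → span (tabulate (proj₁ ∘ Inverse.to ∣S∣≡r)) g
  enumeration-generates S ∣S∣≡r g = generated-⊆
    (λ s∈S → resp-≈ (Inverse.strictlyInverseˡ ∣S∣≡r (_ , s∈S)) (gen (Membershipₚ.∈-tabulate⁺ setoid _)))
    (GeneratingSet.generates S g)

-- Both digraphs from one construction, with Q either trivial or excluding involutions.

theorem2 : (∀ {a} → ExcludedMiddle a) →
    ∀ {c ℓ : Level} (G : Group c ℓ) → FinitelyGenerated G →
    ∀ (r : ℕ) → IsRank G r →
    (∃ λ x → OrderAtLeast G ((5 * r) ^ 12) x) →
    (Σ (GeneratingSet G) λ S →
    Σ (Group.ε G ∉ GeneratingSet.Member S) λ ε∉S →
    LocallyFinite (cayleyDigraph G S ε∉S) ×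
    AutomorphismsAreLeftMultiplications G S ε∉S) ×
    (¬ IsGeneralizedDihedral G →
    Σ (GeneratingSet G) λ S →
    Σ (Group.ε G ∉ GeneratingSet.Member S) λ ε∉S →
    LocallyFinite (cayleyDigraph G S ε∉S) ×
    AutomorphismsAreLeftMultiplications G S ε∉S ×
    WithoutBigons (cayleyDigraph G S ε∉S))
theorem2 em {ℓ = ℓ} G _ r ((S , ∣S∣≡r) , _) (x , order) =
  forget (any r ≡.refl) , λ ¬dihedral → bigonless (oriented r ≡.refl ¬dihedral)
  where
  open GroupLemmas G
  open Powers x
  open Group G using (Carrier; ε; _≈_; _∙_; trans; identityʳ; ∙-congˡ)

  ts : List Carrier
  ts = tabulate (proj₁ ∘ Inverse.to ∣S∣≡r)

  generates : ∀ g → span ts g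
  generates = enumeration-generates S ∣S∣≡r

  ts-length : length ts ≡ r
  ts-length = List.length-tabulate (proj₁ ∘ Inverse.to ∣S∣≡r)

  with-x : ∀ {us} → (∀ g → span us g) → ∀ g → span (x ∷ us) g
  with-x us-generates g = generated-⊆ (gen ∘ there) (us-generates g)

  trivial : r ≡ 0 → ∀ g → span [] g
  trivial r≡0 with ts | ts-length | generates
  ... | []    | _    | generates = generates
  ... | _ ∷ _ | ≡.refl | _ with () ← r≡0

  -- The value R = r + 1 leaves room for the additional generator that `nonInverting-generators` may
  -- introduce.
  x^-inj : ∀ {k} → r ≡ suc k → DistinctPowers (suc (pathLength (suc r) * pathLength (suc r)))
  x^-inj {k} ≡.refl = distinctPowers (order-bound k) order

  x²≉ε : ∀ {k} → r ≡ suc k → ¬ x ∙ x ≈ ε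
  x²≉ε r≡ x²≈ε = contradiction
    (x^-inj r≡ {2} {0} (s≤s (s≤s (s≤s z≤n))) (s≤s z≤n) (trans (∙-congˡ (identityʳ x)) x²≈ε)) λ ()

  any : ∀ k → r ≡ k → Rigid em (λ _ → ⊤)
  -- For r = 0 the bound (5 r)^12 is 0 and gives no information on x, so the trivial group is
  -- treated apart.
  any zero    r≡0 = rigid-trivial em (trivial r≡0)
  any (suc k) r≡  = rigid em x (x^-inj r≡) (ℕ.m≤n⇒m≤1+n (ℕ.≤-reflexive ts-length)) (with-x generates)
    (λ _ _ → tt) (λ _ _ → inj₁ tt)

  oriented : ∀ k → r ≡ k → ¬ IsGeneralizedDihedral G → Rigid em (NonInvolution em)
  oriented zero    r≡0 _ = rigid-trivial em (trivial r≡0)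
  oriented (suc k) r≡ ¬dihedral
    with nonInverting-generators em x (x²≉ε r≡) ¬dihedral ts generates
  ... | us , us≤ , us-generates , us-¬invert = rigid em x (x^-inj r≡)
    (ℕ.≤-trans us≤ (s≤s (ℕ.≤-reflexive ts-length))) (with-x us-generates)
    (nonInvolution-resp em) (λ u∈us → nonInvolution-x^ em x (us-¬invert u∈us))

  forget : ∀ {q} {Q : Pred Carrier q} → Rigid em Q → Σ (GeneratingSet G) λ S →
    Σ (ε ∉ GeneratingSet.Member S) λ ε∉S →
    LocallyFinite (cayleyDigraph G S ε∉S) × AutomorphismsAreLeftMultiplications G S ε∉S
  forget (S , ε∉S , finite , automorphisms , _) = S , ε∉S , finite , automorphisms

  bigonless : Rigid em (NonInvolution em) → Σ (GeneratingSet G) λ S →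
    Σ (ε ∉ GeneratingSet.Member S) λ ε∉S →
    LocallyFinite (cayleyDigraph G S ε∉S) × AutomorphismsAreLeftMultiplications G S ε∉S ×
    WithoutBigons (cayleyDigraph G S ε∉S)
  bigonless R@(S , ε∉S , finite , automorphisms , _) =
    S , ε∉S , finite , automorphisms , withoutBigons em R
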